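{- Let $f:[0,1]\to\mathbb{R}$ be continuous on $[0,1]$ and twice differentiable on $(0,1)$, and define $g(t)=f(\tfrac12+t)$ for $t\in[-\tfrac12,\tfrac12]$. Assume: (1) $g^{(2)}(t)>0$ for $-\tfrac12<t<0$, and $g^{(2)}(0)\ge 0$; (2) $g^{(2)}(t)\ge -g^{(2)}(-t)$ for $0<t<\tfrac12$; (3) $\lim_{t\to-1/2}\frac{1}{g^{(2)}(t)}=0$; (4) the function $t\mapsto \frac{1}{g^{(2)}(t)}$ is convex on $[-\tfrac12,0)$ (its value at $-\tfrac12$ being the limit $0$ from (3)). Then $f$ is simplex-convex.
   Context: A function $f:[0,1]\to\mathbb{R}$ is called simplex-convex if for every $n\ge 1$ the function $(p_1,\dots,p_n)\mapsto f(p_1)+\dots+f(p_n)$ is convex on the simplex $\mathrm{Sim}_n(1)=\{(p_1,\dots,p_n): p_i\ge 0,\ \sum_i p_i=1\}$. -}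

module Defs where

open import Algebra.Bundles using (CommutativeRing)
open import Algebra.Core using (Op₁; Op₂)
open import Algebra.Structures using (IsCommutativeRing)
import Algebra.Construct.NaturalChoice.Max as Max
import Algebra.Properties.CommutativeMonoid.Sum as Sum
open import Data.Bool.Base using (if_then_else_)
open import Data.Nat.Base as ℕ using (ℕ)
open import Data.Product.Base using (∃; ∃-syntax; _×_)
open import Data.Vec.Functional using (Vector)
open import Level using (0ℓ)
open import Relation.Binary.Bundles using (DecTotalOrder; TotalOrder)
open import Relation.Binary.Core using (Rel)
open import Relation.Binary.Structures using (IsDecTotalOrder)
import Relation.Binary.Construct.NonStrictToStrict as ToStrict
open import Relation.Nullary using (¬_; does)
open import Relation.Unary using (Pred; _∈_)

-- The real numbers, given by their categorical axiomatisation.  Equality is a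
-- setoid equality, and, the setting being classical, the order is decidable
-- and the reciprocal is a total function whose value at zero is unspecified.

record CompleteOrderedField : Set₁ where
  infix  8 _⁻¹ -_
  infixl 7 _*_
  infixl 6 _+_
  infix  4 _≈_ _≤_
  field
    Carrier           : Set
    _≈_               : Rel Carrier 0ℓ
    _≤_               : Rel Carrier 0ℓ
    _+_               : Op₂ Carrier
    _*_               : Op₂ Carrier
    -_                : Op₁ Carrier
    _⁻¹               : Op₁ Carrier
    0#                : Carrier
    1#                : Carrier
    isCommutativeRing : IsCommutativeRing _≈_ _+_ _*_ -_ 0# 1#
    0≉1               : ¬ (0# ≈ 1#)
    ⁻¹-cong           : ∀ {x y} → x ≈ y → x ⁻¹ ≈ y ⁻¹
    ⁻¹-inverseʳ       : ∀ {x} → ¬ (x ≈ 0#) → x * x ⁻¹ ≈ 1#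
    isDecTotalOrder   : IsDecTotalOrder _≈_ _≤_
    +-monoˡ-≤         : ∀ z {x y} → x ≤ y → x + z ≤ y + z
    *-nonNegative     : ∀ {x y} → 0# ≤ x → 0# ≤ y → 0# ≤ x * y

  UpperBound : Pred Carrier 0ℓ → Pred Carrier 0ℓ
  UpperBound P b = ∀ {x} → x ∈ P → x ≤ b

  field
    supremum : (P : Pred Carrier 0ℓ) → ∃ P → ∃ (UpperBound P) →
               ∃[ s ] s ∈ UpperBound P × (∀ {b} → b ∈ UpperBound P → s ≤ b)

  commutativeRing : CommutativeRing 0ℓ 0ℓ
  commutativeRing = record { isCommutativeRing = isCommutativeRing }

  decTotalOrder : DecTotalOrder 0ℓ 0ℓ 0ℓ
  decTotalOrder = record { isDecTotalOrder = isDecTotalOrder }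

  totalOrder : TotalOrder 0ℓ 0ℓ 0ℓ
  totalOrder = DecTotalOrder.totalOrder decTotalOrder

  open IsDecTotalOrder isDecTotalOrder public using (_≟_; _≤?_)
  open CommutativeRing commutativeRing public using (+-commutativeMonoid)
  open ToStrict _≈_ _≤_ public using (_<_)
  open Max totalOrder public using (_⊔_)
  open Sum +-commutativeMonoid public using (sum)

  infixl 6 _-_
  _-_ : Op₂ Carrier
  x - y = x + - y

  infixl 7 _/_
  _/_ : Op₂ Carrier
  x / y = x * y ⁻¹

  ∣_∣ : Op₁ Carrier
  ∣ x ∣ = x ⊔ (- x)

  ½ : Carrier
  ½ = 1# / (1# + 1#)

-- Functions on a subset D of the line are represented by total functions of
-- which only the values on D are used.

module Analysis (ℝ : CompleteOrderedField) where
  open CompleteOrderedField ℝ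

  ⟦_,_⟧ ⟦_,_⦆ ⦅_,_⦆ : Carrier → Carrier → Pred Carrier 0ℓ
  ⟦ a , b ⟧ x = a ≤ x × x ≤ b
  ⟦ a , b ⦆ x = a ≤ x × x < b
  ⦅ a , b ⦆ x = a < x × x < b

  -- For a continuous function this includes compatibility with _≈_ on D
  -- (take y ≈ x), so it need not be assumed separately.
  ContinuousOn : Pred Carrier 0ℓ → (Carrier → Carrier) → Set
  ContinuousOn D h =
    ∀ {x} → x ∈ D → ∀ {ε} → 0# < ε → ∃[ δ ] 0# < δ ×
      (∀ {y} → y ∈ D → ∣ y - x ∣ < δ → ∣ h y - h x ∣ < ε)

  -- h t → L as t → a, with t in D and t different from a.
  Limit : Pred Carrier 0ℓ → (Carrier → Carrier) → Carrier → Carrier → Set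
  Limit D h a L =
    ∀ {ε} → 0# < ε → ∃[ δ ] 0# < δ ×
      (∀ {t} → t ∈ D → 0# < ∣ t - a ∣ → ∣ t - a ∣ < δ → ∣ h t - L ∣ < ε)

  DerivativeOn : Pred Carrier 0ℓ → (h h′ : Carrier → Carrier) → Set
  DerivativeOn D h h′ =
    ∀ {x} → x ∈ D → Limit D (λ y → (h y - h x) / (y - x)) x (h′ x)

  SecondDerivativeOn : Pred Carrier 0ℓ → (h h″ : Carrier → Carrier) → Set
  SecondDerivativeOn D h h″ =
    ∃[ h′ ] DerivativeOn D h h′ × DerivativeOn D h′ h″

  TwiceDifferentiableOn : Pred Carrier 0ℓ → (Carrier → Carrier) → Set
  TwiceDifferentiableOn D h = ∃[ h″ ] SecondDerivativeOn D h h″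

  ConvexOn : Pred Carrier 0ℓ → (Carrier → Carrier) → Set
  ConvexOn D h =
    ∀ {x y} → x ∈ D → y ∈ D → ∀ {s} → s ∈ ⟦ 0# , 1# ⟧ →
      h (s * x + (1# - s) * y) ≤ s * h x + (1# - s) * h y

  ConvexOnⁿ : ∀ {n} → Pred (Vector Carrier n) 0ℓ → (Vector Carrier n → Carrier) → Set
  ConvexOnⁿ D F =
    ∀ {p q} → p ∈ D → q ∈ D → ∀ {s} → s ∈ ⟦ 0# , 1# ⟧ →
      F (λ i → s * p i + (1# - s) * q i) ≤ s * F p + (1# - s) * F q

  Simplex : ∀ n → Pred (Vector Carrier n) 0ℓ
  Simplex n p = (∀ i → 0# ≤ p i) × sum p ≈ 1#

  SimplexConvex : (Carrier → Carrier) → Set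
  SimplexConvex f =
    ∀ n → 1 ℕ.≤ n → ConvexOnⁿ (Simplex n) (λ p → sum (λ i → f (p i)))

  -- The function h with its value at a replaced by v.
  withValueAt : (a v : Carrier) → (Carrier → Carrier) → Carrier → Carrier
  withValueAt a v h t = if does (t ≟ a) then v else h t

{-# OPTIONS --safe #-}
module Submission where

-- Along a segment of the simplex with direction Δ, the second derivative of Σ f(pᵢ)
-- is Σ f″(pᵢ) Δᵢ² with Σ Δᵢ = 0.  Only an entry pₖ > ½ can contribute negatively, and
-- by (2) its term is at least - f″(P) Δₖ², where P = 1 - pₖ is the sum of the other entries.
-- By (4), x ↦ x f″(x) is decreasing on (0, ½), so f″(pᵢ) ≥ P f″(P) / pᵢ for i ≠ k, and
-- Cauchy–Schwarz gives Σ Δᵢ² / pᵢ ≥ Δₖ² / P over these i.  Coordinates that are constant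
-- along the segment drop out and all others are interior to [0,1] inside it, so f need
-- not be differentiable at 0 and 1.

-- The second derivative of the sum is never formed. It is replaced by lower bounds on symmetric
-- second differences, which add up over coordinates, vanish for constant ones and scale by Δᵢ²
-- under an affine substitution; a coordinate resting at an end of [0,1], where only continuity is
-- available, can thus be summed together with the moving ones.
--
-- The model for (4) is entropy, f″(x) = κ/x, for which 1/f″ is linear with value 0 at 0. Below P,
-- any other f″ is compared with the model that agrees with it at P, so κ = P f″(P), and the model's
-- form κ Σ Δᵢ²/pᵢ is what Cauchy-Schwarz estimates. That estimate is used in multiplier form, as a
-- sum checked coordinate by coordinate, so that no division by a vanishing pᵢ occurs.
--
-- All compactness rests on one supremum argument, which yields both the existence of maxima and
-- monotonicity from the sign of a derivative.

open import Defs
open import Algebra.Bundles using (CommutativeRing)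
import Algebra.Construct.NaturalChoice.Max as Max
import Algebra.Properties.CommutativeMonoid.Sum as Sum
import Algebra.Properties.Ring
import Algebra.Properties.Semiring.Mult.TCOptimised
import Algebra.Solver.Ring
open import Algebra.Solver.Ring.AlmostCommutativeRing using (fromCommutativeRing; _-Raw-AlmostCommutative⟶_)
open import Axiom.ExcludedMiddle using (ExcludedMiddle)
open import Data.Empty using (⊥; ⊥-elim)
open import Data.Fin.Base using (Fin; zero; suc)
import Data.Fin.Properties as Fin
open import Data.Integer.Base as ℤ using (ℤ; +_; -[1+_])
import Data.Integer.Properties as ℤ
open import Data.Maybe.Base using (Maybe; map)
open import Data.Nat.Base as ℕ using (ℕ; zero; suc)
import Data.Nat.Properties as ℕ
open import Data.Product.Base using (∃; ∃-syntax; _×_; _,_; proj₁; proj₂)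
open import Data.Sum.Base using (_⊎_; inj₁; inj₂)
open import Function.Base using (case_of_; _∘_)
open import Level using (0ℓ)
open import Relation.Binary.Bundles using (DecTotalOrder)
open import Relation.Binary.Core using (Rel)
import Relation.Binary.Properties.TotalOrder
open import Relation.Binary.PropositionalEquality.Core as ≡ using (_≡_; _≢_)
open import Relation.Nullary using (¬_; yes; no)
open import Relation.Nullary.Decidable using (dec⇒maybe)
open import Relation.Unary using (Pred; _∈_)

-- Integer coefficients have a decidable propositional equality that computes,
-- so the solver can cancel terms, which the ring's own coefficients would not.
module IntegerSolver {c ℓ} (R : CommutativeRing c ℓ) where
  open CommutativeRing R
  open Algebra.Properties.Ring ring
  open Algebra.Properties.Semiring.Mult.TCOptimised semiring using (1+×; ×-homo-+; ×1-homo-*)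
    renaming (_×_ to _·_)
  open import Relation.Binary.Reasoning.Setoid setoid

  ⟦_⟧ℤ : ℤ → Carrier
  ⟦ + n ⟧ℤ      = n · 1#
  ⟦ -[1+ n ] ⟧ℤ = - (suc n · 1#)

  cancelˡ : ∀ x y z → (x + y) - (x + z) ≈ y - z
  cancelˡ x y z = begin
    (x + y) - (x + z)       ≈⟨ +-cong (+-comm x y) (sym (-‿+-comm x z)) ⟩
    (y + x) + (- x + - z)   ≈⟨ +-assoc y x _ ⟩
    y + (x + (- x + - z))   ≈⟨ +-congˡ (+-assoc x (- x) (- z)) ⟨
    y + ((x + - x) + - z)   ≈⟨ +-congˡ (+-congʳ (-‿inverseʳ x)) ⟩
    y + (0# + - z)          ≈⟨ +-congˡ (+-identityˡ (- z)) ⟩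
    y - z                   ∎

  ⊖-homo : ∀ m n → ⟦ m ℤ.⊖ n ⟧ℤ ≈ m · 1# - n · 1#
  ⊖-homo zero    zero    = sym (-‿inverseʳ 0#)
  ⊖-homo zero    (suc n) = sym (+-identityˡ _)
  ⊖-homo (suc m) zero    = sym (trans (+-congˡ -0#≈0#) (+-identityʳ _))
  ⊖-homo (suc m) (suc n) = begin
    ⟦ suc m ℤ.⊖ suc n ⟧ℤ            ≡⟨ ≡.cong ⟦_⟧ℤ (ℤ.[1+m]⊖[1+n]≡m⊖n m n) ⟩
    ⟦ m ℤ.⊖ n ⟧ℤ                    ≈⟨ ⊖-homo m n ⟩
    m · 1# - n · 1#                 ≈⟨ cancelˡ 1# _ _ ⟨
    (1# + m · 1#) - (1# + n · 1#)   ≈⟨ +-cong (1+× m 1#) (-‿cong (1+× n 1#)) ⟨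
    suc m · 1# - suc n · 1#         ∎

  neg-homo : ∀ i → ⟦ ℤ.- i ⟧ℤ ≈ - ⟦ i ⟧ℤ
  neg-homo (+ zero)   = sym -0#≈0#
  neg-homo (+ suc n)  = refl
  neg-homo -[1+ n ]   = sym (-‿involutive _)

  +-homo : ∀ i j → ⟦ i ℤ.+ j ⟧ℤ ≈ ⟦ i ⟧ℤ + ⟦ j ⟧ℤ
  +-homo (+ m)    (+ n)    = ×-homo-+ 1# m n
  +-homo (+ m)    -[1+ n ] = ⊖-homo m (suc n)
  +-homo -[1+ m ] (+ n)    = trans (⊖-homo n (suc m)) (+-comm _ _)
  +-homo -[1+ m ] -[1+ n ] = begin
    - (suc (suc (m ℕ.+ n)) · 1#)       ≡⟨ ≡.cong (λ k → - (suc k · 1#)) (≡.sym (ℕ.+-suc m n)) ⟩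
    - ((suc m ℕ.+ suc n) · 1#)         ≈⟨ -‿cong (×-homo-+ 1# (suc m) (suc n)) ⟩
    - (suc m · 1# + suc n · 1#)        ≈⟨ -‿+-comm _ _ ⟨
    - (suc m · 1#) + - (suc n · 1#)    ∎

  pos*-homo : ∀ m j → ⟦ + m ℤ.* j ⟧ℤ ≈ m · 1# * ⟦ j ⟧ℤ
  pos*-homo m (+ n) = begin
    ⟦ + m ℤ.* + n ⟧ℤ     ≡⟨ ≡.cong ⟦_⟧ℤ (ℤ.pos-* m n) ⟨
    (m ℕ.* n) · 1#       ≈⟨ ×1-homo-* m n ⟩
    m · 1# * (n · 1#)    ∎
  pos*-homo m -[1+ n ] = begin
    ⟦ + m ℤ.* -[1+ n ] ⟧ℤ           ≡⟨ ≡.cong ⟦_⟧ℤ (ℤ.neg-distribʳ-* (+ m) (+ suc n)) ⟨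
    ⟦ ℤ.- (+ m ℤ.* + suc n) ⟧ℤ      ≈⟨ neg-homo (+ m ℤ.* + suc n) ⟩
    - ⟦ + m ℤ.* + suc n ⟧ℤ          ≈⟨ -‿cong (pos*-homo m (+ suc n)) ⟩
    - (m · 1# * (suc n · 1#))       ≈⟨ -‿distribʳ-* _ _ ⟩
    m · 1# * - (suc n · 1#)         ∎

  *-homo : ∀ i j → ⟦ i ℤ.* j ⟧ℤ ≈ ⟦ i ⟧ℤ * ⟦ j ⟧ℤ
  *-homo (+ m)    j = pos*-homo m j
  *-homo -[1+ m ] j = begin
    ⟦ -[1+ m ] ℤ.* j ⟧ℤ           ≡⟨ ≡.cong ⟦_⟧ℤ (ℤ.neg-distribˡ-* (+ suc m) j) ⟨
    ⟦ ℤ.- (+ suc m ℤ.* j) ⟧ℤ      ≈⟨ neg-homo (+ suc m ℤ.* j) ⟩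
    - ⟦ + suc m ℤ.* j ⟧ℤ          ≈⟨ -‿cong (pos*-homo (suc m) j) ⟩
    - (suc m · 1# * ⟦ j ⟧ℤ)       ≈⟨ -‿distribˡ-* _ _ ⟩
    - (suc m · 1#) * ⟦ j ⟧ℤ       ∎

  morphism : ℤ.+-*-rawRing -Raw-AlmostCommutative⟶ fromCommutativeRing R
  morphism = record
    { ⟦_⟧    = ⟦_⟧ℤ
    ; +-homo = +-homo
    ; *-homo = *-homo
    ; -‿homo = neg-homo
    ; 0-homo = refl
    ; 1-homo = refl
    }

  _coeff≟_ : ∀ i j → Maybe (⟦ i ⟧ℤ ≈ ⟦ j ⟧ℤ)
  i coeff≟ j = map (λ i≡j → reflexive (≡.cong ⟦_⟧ℤ i≡j)) (dec⇒maybe (i ℤ.≟ j))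

  open Algebra.Solver.Ring ℤ.+-*-rawRing (fromCommutativeRing R) morphism _coeff≟_ public
    using (Polynomial; solve; con; _:=_; _:+_; _:*_; _:-_; :-_)

  :0 :1 : ∀ {n} → Polynomial n
  :0 = con (+ 0)
  :1 = con (+ 1)

-- Arithmetic in an ordered field.

module OrderedField (ℝ : CompleteOrderedField) where
  open CompleteOrderedField ℝ
  open CommutativeRing commutativeRing public
    using (refl; sym; trans; +-cong; +-congˡ; +-congʳ; *-congˡ; *-congʳ; -‿cong; *-identityˡ)
  open DecTotalOrder decTotalOrder public
    using (total; antisym; ≤-respˡ-≈; ≤-respʳ-≈)
    renaming (refl to ≤-refl; reflexive to ≤-reflexive; trans to ≤-trans)
  open Relation.Binary.Properties.TotalOrder totalOrder public
    using (<-respʳ-≈; <-respˡ-≈; <⇒≱; ≰⇒>; <-irrefl; <-trans)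
  open Max totalOrder using (x≤x⊔y; x≤y⊔x; ⊔-lub; ⊔-cong)
  open IntegerSolver commutativeRing public

  variable
    a b c d e u v w x y z δ ε : Carrier

  -- Lets an identity found by the ring solver be used modulo a hypothesis a ≈ b;
  -- nested uses consume the correction terms from the last one.
  ≈-mod : ∀ c → u ≈ v + c * (a - b) → a ≈ b → u ≈ v
  ≈-mod {u} {v} {a} {b} c eq a≈b = trans eq (trans (+-congˡ (*-congˡ (+-congʳ a≈b)))
    (solve 3 (λ v c b → v :+ c :* (b :- b) := v) refl v c b))

  x≤y⇒0≤y-x : x ≤ y → 0# ≤ y - x
  x≤y⇒0≤y-x {x} {y} p = ≤-respˡ-≈ (solve 1 (λ x → x :- x := :0) refl x) (+-monoˡ-≤ (- x) p)

  -- The pattern of nearly all inequalities below: the difference is written as an expression `e`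
  -- that is visibly nonnegative, and the ring solver certifies the identity.
  ≤-by : 0# ≤ e → y - x ≈ e → x ≤ y
  ≤-by {e} {y} {x} 0≤e eq = ≤-resp₂ (+-monoˡ-≤ x (≤-respʳ-≈ (sym eq) 0≤e))
    where
    ≤-resp₂ : 0# + x ≤ y - x + x → x ≤ y
    ≤-resp₂ p = ≤-respˡ-≈ (solve 1 (λ x → :0 :+ x := x) refl x)
      (≤-respʳ-≈ (solve 2 (λ x y → y :- x :+ x := y) refl x y) p)

  x<y⇒0<y-x : x < y → 0# < y - x
  x<y⇒0<y-x {x} {y} (x≤y , x≉y) = x≤y⇒0≤y-x x≤y , λ 0≈y-x →
    x≉y (≈-mod (- 1#) (solve 2 (λ x y → x := y :+ (:- :1) :* (y :- x :- :0)) refl x y) (sym 0≈y-x))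

  <-by : 0# < e → y - x ≈ e → x < y
  <-by {e} {y} {x} (0≤e , 0≉e) eq = ≤-by 0≤e eq , λ x≈y →
    0≉e (trans (trans (solve 1 (λ x → :0 := x :- x) refl x) (+-congʳ x≈y)) eq)

  _⊕_ : 0# ≤ x → 0# ≤ y → 0# ≤ x + y
  _⊕_ {x} {y} 0≤x 0≤y = ≤-trans 0≤x (≤-by 0≤y (solve 2 (λ x y → x :+ y :- x := y) refl x y))

  _⊗_ : 0# ≤ x → 0# ≤ y → 0# ≤ x * y
  _⊗_ = *-nonNegative

  infixl 6 _⊕_ _+⊕_
  infixl 7 _⊗_ _+⊗_

  <-≤-trans : x < y → y ≤ z → x < z
  <-≤-trans (x≤y , x≉y) y≤z = ≤-trans x≤y y≤z , λ x≈z → x≉y (antisym x≤y (≤-respʳ-≈ (sym x≈z) y≤z))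

  ≤-<-trans : x ≤ y → y < z → x < z
  ≤-<-trans x≤y (y≤z , y≉z) = ≤-trans x≤y y≤z , λ x≈z → y≉z (antisym y≤z (≤-respˡ-≈ x≈z x≤y))

  _+⊕_ : 0# < x → 0# ≤ y → 0# < x + y
  _+⊕_ {x} {y} 0<x 0≤y = <-≤-trans 0<x (≤-by 0≤y (solve 2 (λ x y → x :+ y :- x := y) refl x y))

  ⁻¹-inverse : 0# < x → x * x ⁻¹ ≈ 1#
  ⁻¹-inverse (_ , 0≉x) = ⁻¹-inverseʳ (λ x≈0 → 0≉x (sym x≈0))

  x*y≈0⇒y≈0 : 0# < x → x * y ≈ 0# → y ≈ 0#
  x*y≈0⇒y≈0 {x} {y} 0<x xy≈0 = ≈-mod (x ⁻¹)
    (≈-mod (- y) (solve 3 (λ x y r → y := :0 :+ r :* (x :* y :- :0) :+ (:- y) :* (x :* r :- :1))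
        refl x y (x ⁻¹))
      (⁻¹-inverse 0<x)) xy≈0

  _+⊗_ : 0# < x → 0# < y → 0# < x * y
  0<x +⊗ 0<y = proj₁ 0<x ⊗ proj₁ 0<y , λ 0≈xy → proj₂ 0<y (sym (x*y≈0⇒y≈0 0<x (sym 0≈xy)))

  sq-nonneg : ∀ x → 0# ≤ x * x
  sq-nonneg x with total 0# x
  ... | inj₁ 0≤x = 0≤x ⊗ 0≤x
  ... | inj₂ x≤0 = ≤-respʳ-≈ (solve 1 (λ x → (:0 :- x) :* (:0 :- x) := x :* x) refl x)
                     (x≤y⇒0≤y-x x≤0 ⊗ x≤y⇒0≤y-x x≤0)

  0<1 : 0# < 1#
  0<1 = ≤-respʳ-≈ (*-identityˡ 1#) (sq-nonneg 1#) , 0≉1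

  ⁻¹-pos : 0# < x → 0# < x ⁻¹
  ⁻¹-pos {x} 0<x = ≰⇒> λ r≤0 → <⇒≱ 0<1 (≤-by (proj₁ 0<x ⊗ x≤y⇒0≤y-x r≤0)
    (≈-mod 1# (solve 2 (λ x r → :0 :- :1 := x :* (:0 :- r) :+ :1 :* (x :* r :- :1)) refl x (x ⁻¹))
      (⁻¹-inverse 0<x)))

  *-cancelˡ-nonneg : 0# < x → 0# ≤ x * y → 0# ≤ y
  *-cancelˡ-nonneg {x} {y} 0<x 0≤xy = ≤-respʳ-≈
    (≈-mod y (solve 3 (λ x y r → r :* (x :* y) := y :+ y :* (x :* r :- :1)) refl x y (x ⁻¹)) (⁻¹-inverse 0<x))
    (proj₁ (⁻¹-pos 0<x) ⊗ 0≤xy)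

  ½-twice : ½ + ½ ≈ 1#
  ½-twice = trans (solve 1 (λ r → :1 :* r :+ :1 :* r := (:1 :+ :1) :* r) refl _)
                  (⁻¹-inverse (0<1 +⊕ proj₁ 0<1))

  0<½ : 0# < ½
  0<½ = 0<1 +⊗ ⁻¹-pos (0<1 +⊕ proj₁ 0<1)

  half< : 0# < ε → ½ * ε < ε
  half< {ε} 0<ε = <-by (0<½ +⊗ 0<ε) (≈-mod (- ε) (solve 2
      (λ h ε → ε :- h :* ε := h :* ε :+ (:- ε) :* (h :+ h :- :1)) refl ½ ε) ½-twice)

  -- If `y < x`, half the gap serves as a contradictory `ε`.
  ≤-limit : (∀ {ε} → 0# < ε → x ≤ y + ε) → x ≤ y
  ≤-limit {x} {y} x≤y+ε with x ≤? y
  ... | yes x≤y = x≤y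
  ... | no  x≰y = ⊥-elim (<⇒≱ (<-by (0<½ +⊗ 0<d) (≈-mod (y - x)
          (solve 3 (λ x y h → x :- (y :+ h :* (x :- y)) := h :* (x :- y) :+ (y :- x) :* (h :+ h :- :1))
              refl x y ½) ½-twice))
        (x≤y+ε (0<½ +⊗ 0<d)))
    where
    0<d : 0# < x - y
    0<d = x<y⇒0<y-x (≰⇒> x≰y)

  minPos : 0# < u → 0# < v → ∃[ δ ] 0# < δ × δ ≤ u × δ ≤ v
  minPos {u} {v} 0<u 0<v with total u v
  ... | inj₁ u≤v = u , 0<u , ≤-refl , u≤v
  ... | inj₂ v≤u = v , 0<v , v≤u , ≤-refl

  -- The witness is `ε / (1# + c)`: dividing by `1# + c` instead of `c` admits `c ≈ 0#` and makes
  -- the inequality strict.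
  scaleSmall : 0# ≤ c → 0# < ε → ∃[ δ ] 0# < δ × c * δ < ε
  scaleSmall {c} {ε} 0≤c 0<ε = ε * r , 0<εr ,
    <-by 0<εr (≈-mod (- ε) (solve 3 (λ c ε r → ε :- c :* (ε :* r) := ε :* r :+ (:- ε) :* ((:1 :+ c) :* r :- :1))
        refl c ε r)
      (⁻¹-inverse (0<1 +⊕ 0≤c)))
    where
    r = (1# + c) ⁻¹
    0<εr : 0# < ε * r
    0<εr = 0<ε +⊗ ⁻¹-pos (0<1 +⊕ 0≤c)

  -- Absolute value.

  x≤∣x∣ : ∀ x → x ≤ ∣ x ∣
  x≤∣x∣ x = x≤x⊔y x (- x)

  -x≤∣x∣ : ∀ x → - x ≤ ∣ x ∣
  -x≤∣x∣ x = x≤y⊔x x (- x)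

  ∣∣-lub : x ≤ b → - x ≤ b → ∣ x ∣ ≤ b
  ∣∣-lub = ⊔-lub

  ∣∣-cong : x ≈ y → ∣ x ∣ ≈ ∣ y ∣
  ∣∣-cong x≈y = ⊔-cong x≈y (-‿cong x≈y)

  0≤∣x∣ : ∀ x → 0# ≤ ∣ x ∣
  0≤∣x∣ x with total 0# x
  ... | inj₁ 0≤x = ≤-trans 0≤x (x≤∣x∣ x)
  ... | inj₂ x≤0 = ≤-trans (≤-by (x≤y⇒0≤y-x x≤0) (solve 1 (λ x → (:- x) :- :0 := :0 :- x) refl x)) (-x≤∣x∣ x)

  0≤x⇒∣x∣≈x : 0# ≤ x → ∣ x ∣ ≈ x
  0≤x⇒∣x∣≈x {x} 0≤x = antisym (∣∣-lub ≤-refl (≤-by (0≤x ⊕ 0≤x) (solve 1 (λ x → x :- (:- x) := x :+ x) refl x)))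
      (x≤∣x∣ x)

  ∣-x∣≈∣x∣ : ∀ x → ∣ - x ∣ ≈ ∣ x ∣
  ∣-x∣≈∣x∣ x = antisym (∣∣-lub (-x≤∣x∣ x) (≤-respˡ-≈ (solve 1 (λ x → x := :- (:- x)) refl x) (x≤∣x∣ x)))
    (∣∣-lub (≤-respˡ-≈ (solve 1 (λ x → :- (:- x) := x) refl x) (-x≤∣x∣ (- x))) (x≤∣x∣ (- x)))

  ∣x-y∣≈∣y-x∣ : ∀ x y → ∣ x - y ∣ ≈ ∣ y - x ∣
  ∣x-y∣≈∣y-x∣ x y = trans (∣∣-cong (solve 2 (λ x y → x :- y := :- (y :- x)) refl x y)) (∣-x∣≈∣x∣ (y - x))

  x≤y⇒∣y-x∣≈y-x : x ≤ y → ∣ y - x ∣ ≈ y - x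
  x≤y⇒∣y-x∣≈y-x x≤y = 0≤x⇒∣x∣≈x (x≤y⇒0≤y-x x≤y)

  x≤y⇒∣x-y∣≈y-x : x ≤ y → ∣ x - y ∣ ≈ y - x
  x≤y⇒∣x-y∣≈y-x x≤y = trans (∣x-y∣≈∣y-x∣ _ _) (x≤y⇒∣y-x∣≈y-x x≤y)

  ∣x∣≈0⇒x≈0 : ∣ x ∣ ≈ 0# → x ≈ 0#
  ∣x∣≈0⇒x≈0 {x} eq = antisym (≤-respʳ-≈ eq (x≤∣x∣ x))
    (≤-by (x≤y⇒0≤y-x (≤-respʳ-≈ eq (-x≤∣x∣ x))) (solve 1 (λ x → x :- :0 := :0 :- (:- x)) refl x))

  y≉x⇒0<∣y-x∣ : ¬ (y ≈ x) → 0# < ∣ y - x ∣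
  y≉x⇒0<∣y-x∣ {y} {x} y≉x = 0≤∣x∣ _ , λ 0≈∣∣ → y≉x (≈-mod 1#
    (solve 2 (λ x y → y := x :+ :1 :* (y :- x :- :0)) refl x y) (∣x∣≈0⇒x≈0 (sym 0≈∣∣)))

  y≈x⇒∣y-x∣≈0 : y ≈ x → ∣ y - x ∣ ≈ 0#
  y≈x⇒∣y-x∣≈0 {y} {x} y≈x = trans (∣∣-cong (trans (+-congʳ y≈x) (solve 1 (λ x → x :- x := :0) refl x)))
      (0≤x⇒∣x∣≈x ≤-refl)

  ∣x+y∣≤∣x∣+∣y∣ : ∀ x y → ∣ x + y ∣ ≤ ∣ x ∣ + ∣ y ∣
  ∣x+y∣≤∣x∣+∣y∣ x y = ∣∣-lub
    (≤-by (x≤y⇒0≤y-x (x≤∣x∣ x) ⊕ x≤y⇒0≤y-x (x≤∣x∣ y))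
        (solve 4 (λ x y a b → a :+ b :- (x :+ y) := (a :- x) :+ (b :- y)) refl x y ∣ x ∣ ∣ y ∣))
    (≤-by (x≤y⇒0≤y-x (-x≤∣x∣ x) ⊕ x≤y⇒0≤y-x (-x≤∣x∣ y))
        (solve 4 (λ x y a b → a :+ b :- (:- (x :+ y)) := (a :- (:- x)) :+ (b :- (:- y))) refl x y ∣ x ∣ ∣ y ∣))

  -- Taking `b` to be `∣ x ∣` gives the product bound; taking it to be `ε` turns an estimate of a
  -- difference quotient into one of the linear error.
  ∣x*y∣≤b*∣y∣ : ∀ y → ∣ x ∣ ≤ b → ∣ x * y ∣ ≤ b * ∣ y ∣
  ∣x*y∣≤b*∣y∣ {x} {b} y ∣x∣≤b with total 0# y
  ... | inj₁ 0≤y = ≤-respʳ-≈ (*-congˡ (sym (0≤x⇒∣x∣≈x 0≤y))) (∣∣-lub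
      (≤-by (x≤y⇒0≤y-x (≤-trans (x≤∣x∣ x) ∣x∣≤b) ⊗ 0≤y) (solve 3 (λ x y b → b :* y :- x :* y := (b :- x) :* y)
          refl x y b))
      (≤-by (x≤y⇒0≤y-x (≤-trans (-x≤∣x∣ x) ∣x∣≤b) ⊗ 0≤y)
          (solve 3 (λ x y b → b :* y :- (:- (x :* y)) := (b :- (:- x)) :* y) refl x y b)))
  ... | inj₂ y≤0 = ≤-respʳ-≈ (*-congˡ (trans (sym (x≤y⇒∣x-y∣≈y-x y≤0))
      (∣∣-cong (solve 1 (λ y → y :- :0 := y) refl y)))) (∣∣-lub
      (≤-by (x≤y⇒0≤y-x (≤-trans (-x≤∣x∣ x) ∣x∣≤b) ⊗ x≤y⇒0≤y-x y≤0)
          (solve 3 (λ x y b → b :* (:0 :- y) :- x :* y := (b :- (:- x)) :* (:0 :- y)) refl x y b))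
      (≤-by (x≤y⇒0≤y-x (≤-trans (x≤∣x∣ x) ∣x∣≤b) ⊗ x≤y⇒0≤y-x y≤0)
          (solve 3 (λ x y b → b :* (:0 :- y) :- (:- (x :* y)) := (b :- x) :* (:0 :- y)) refl x y b)))

-- Compactness and derivatives on an interval.

module RealAnalysis (em : ExcludedMiddle 0ℓ) (ℝ : CompleteOrderedField) where
  open CompleteOrderedField ℝ
  open Analysis ℝ
  open OrderedField ℝ

  private variable
    n : ℕ
    D E : Pred Carrier 0ℓ
    h k : Carrier → Carrier
    A B L M : Carrier

  -- If no element of `S` lay within `δ` of `s`, then `s - δ` would be an upper bound below the
  -- least one.
  supremum-approached : (S : Pred Carrier 0ℓ) → ∃ S → ∃ (UpperBound S) →
    ∃[ s ] s ∈ UpperBound S × (∀ {b} → b ∈ UpperBound S → s ≤ b) ×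
      (∀ {δ} → 0# < δ → ∃[ u ] u ∈ S × ∣ u - s ∣ < δ)
  supremum-approached S inhabited bounded with supremum S inhabited bounded
  ... | s , S≤s , least = s , S≤s , least , approach
    where
    approach : ∀ {δ} → 0# < δ → ∃[ u ] u ∈ S × ∣ u - s ∣ < δ
    approach {δ} 0<δ with em {P = ∃[ u ] u ∈ S × ∣ u - s ∣ < δ}
    ... | yes found = found
    ... | no  none  = ⊥-elim (<⇒≱ (<-by 0<δ (solve 2 (λ s δ → s :- (s :- δ) := δ) refl s δ))
        (least λ {u} → below u))
      where
      below : ∀ u → u ∈ S → u ≤ s - δ
      below u u∈S with u ≤? (s - δ)
      ... | yes u≤ = u≤
      ... | no  u≰ = ⊥-elim (none (u , u∈S , <-respˡ-≈ (sym (x≤y⇒∣x-y∣≈y-x (S≤s u∈S)))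
          (<-by (x<y⇒0<y-x (≰⇒> u≰)) (solve 3 (λ s δ u → δ :- (s :- u) := u :- (s :- δ)) refl s δ u))))

  -- Cousin's lemma, phrased with a transitive relation instead of tagged partitions.
  cousin : (P : Rel Carrier 0ℓ) → (∀ {x y z} → P x y → P y z → P x z) → a ≤ b →
    (∀ {x} → x ∈ ⟦ a , b ⟧ → ∃[ δ ] 0# < δ × (∀ {u v} → u ∈ ⟦ a , b ⟧ → v ∈ ⟦ a , b ⟧ →
      u ≤ x → x ≤ v → ∣ u - x ∣ < δ → ∣ v - x ∣ < δ → P u v)) →
    P a b
  cousin {a} {b} P P-trans a≤b local = reach (supremum-approached S (a , a∈S) (b , λ x∈S → proj₂ (proj₁ x∈S)))
    where
    S : Pred Carrier 0ℓ
    S x = x ∈ ⟦ a , b ⟧ × P a x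

    near : ∀ x → 0# < δ → ∣ x - x ∣ < δ
    near x 0<δ = <-respˡ-≈ (sym (y≈x⇒∣y-x∣≈0 refl)) 0<δ

    a∈S : a ∈ S
    a∈S with local (≤-refl , a≤b)
    ... | _ , 0<δ , straddle =
      (≤-refl , a≤b) , straddle (≤-refl , a≤b) (≤-refl , a≤b) ≤-refl ≤-refl (near a 0<δ) (near a 0<δ)

    -- An interval starting at a point `u` of `S` close to the supremum `s` leaps across `s`,
    -- whether or not `s` itself lies in `S`. If `s` is `b`, it ends there; otherwise it ends at
    -- `s + ½ * η`, which then belongs to `S` and exceeds its supremum.
    reach : ∃[ s ] s ∈ UpperBound S × (∀ {b} → b ∈ UpperBound S → s ≤ b) ×
      (∀ {δ} → 0# < δ → ∃[ u ] u ∈ S × ∣ u - s ∣ < δ) → P a b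
    reach (s , S≤s , least , approach) = case local (S≤s a∈S , s≤b) of λ
      (δ , 0<δ , straddle) → case approach 0<δ of λ
      (u , (u∈ , Pau) , u-near) → case b ≤? s of λ
        { (yes b≤s) → P-trans Pau (straddle u∈ (a≤b , ≤-refl) (S≤s (u∈ , Pau)) s≤b u-near
            (<-respˡ-≈ (sym (y≈x⇒∣y-x∣≈0 (antisym b≤s s≤b))) 0<δ))
        ; (no b≰s) → case minPos 0<δ (x<y⇒0<y-x (≰⇒> b≰s)) of λ
            (η , 0<η , η≤δ , η≤b-s) →
              let v∈ = ≤-trans (S≤s a∈S) (s≤s+k 0<η) , step-below η≤b-s 0<η
              in ⊥-elim (<⇒≱ (s<s+k 0<η) (S≤s (v∈ , P-trans Pau
                  (straddle u∈ v∈ (S≤s (u∈ , Pau)) (s≤s+k 0<η) u-near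
                (<-respˡ-≈ (sym (trans (x≤y⇒∣y-x∣≈y-x (s≤s+k 0<η)) (s+k-s η)))
                    (<-≤-trans (half< 0<η) η≤δ)))))) }
      where
      s≤b : s ≤ b
      s≤b = least (λ x∈S → proj₂ (proj₁ x∈S))
      s+k-s : ∀ η → s + ½ * η - s ≈ ½ * η
      s+k-s η = solve 2 (λ s k → s :+ k :- s := k) refl s (½ * η)
      s<s+k : 0# < ε → s < s + ½ * ε
      s<s+k 0<ε = <-by (0<½ +⊗ 0<ε) (s+k-s _)
      s≤s+k : 0# < ε → s ≤ s + ½ * ε
      s≤s+k 0<ε = proj₁ (s<s+k 0<ε)
      step-below : ε ≤ b - s → 0# < ε → s + ½ * ε ≤ b
      step-below {ε} ε≤b-s 0<ε = ≤-by (x≤y⇒0≤y-x (≤-trans (proj₁ (half< 0<ε)) ε≤b-s))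
        (solve 3 (λ s k b → b :- (s :+ k) := b :- s :- k) refl s (½ * ε) b)

  between-near : u ≤ w → w ≤ v → ∣ u - x ∣ < δ → ∣ v - x ∣ < δ → ∣ w - x ∣ < δ
  between-near {u} {w} {v} {x} u≤w w≤v u-near v-near with total w x
  ... | inj₁ w≤x = ≤-<-trans (≤-respˡ-≈ (sym (x≤y⇒∣x-y∣≈y-x w≤x))
      (≤-trans (≤-by (x≤y⇒0≤y-x u≤w) (solve 3 (λ u w x → (:- (u :- x)) :- (x :- w) := w :- u) refl u w x))
          (-x≤∣x∣ (u - x)))) u-near
  ... | inj₂ x≤w = ≤-<-trans (≤-respˡ-≈ (sym (x≤y⇒∣y-x∣≈y-x x≤w))
      (≤-trans (≤-by (x≤y⇒0≤y-x w≤v) (solve 3 (λ v w x → (v :- x) :- (w :- x) := v :- w) refl v w x))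
          (x≤∣x∣ (v - x)))) v-near

  -- Without a maximum every value is exceeded by another one, which by continuity dominates a whole
  -- neighbourhood. On adjacent intervals the larger of the two dominating values serves for both,
  -- so by Cousin's lemma one value would dominate the whole interval, itself included.
  maximum : ∀ K → ContinuousOn ⟦ a , b ⟧ K → a ≤ b → ∃[ c ] c ∈ ⟦ a , b ⟧ × (∀ {y} → y ∈ ⟦ a , b ⟧ → K y ≤ K c)
  maximum {a} {b} K K-cont a≤b with em {P = ∃[ c ] c ∈ ⟦ a , b ⟧ × (∀ {y} → y ∈ ⟦ a , b ⟧ → K y ≤ K c)}
  ... | yes found = found
  ... | no  none  = ⊥-elim (absurd (cousin Dominated Dominated-trans a≤b local))
    where
    Dominated : Rel Carrier 0ℓ
    Dominated u v = ∃[ y ] y ∈ ⟦ a , b ⟧ × (∀ {w} → u ≤ w → w ≤ v → K w < K y)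

    Dominated-trans : ∀ {x y z} → Dominated x y → Dominated y z → Dominated x z
    Dominated-trans {y = y} (p , p∈ , <p) (q , q∈ , <q) with total (K p) (K q)
    ... | inj₁ p≤q = q , q∈ , λ {w} x≤w w≤z → case (total w y) x≤w w≤z
      where
      case : ∀ {w} → w ≤ y ⊎ y ≤ w → _ ≤ w → w ≤ _ → K w < K q
      case (inj₁ w≤y) x≤w w≤z = <-≤-trans (<p x≤w w≤y) p≤q
      case (inj₂ y≤w) x≤w w≤z = <q y≤w w≤z
    ... | inj₂ q≤p = p , p∈ , λ {w} x≤w w≤z → case (total w y) x≤w w≤z
      where
      case : ∀ {w} → w ≤ y ⊎ y ≤ w → _ ≤ w → w ≤ _ → K w < K p
      case (inj₁ w≤y) x≤w w≤z = <p x≤w w≤y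
      case (inj₂ y≤w) x≤w w≤z = <-≤-trans (<q y≤w w≤z) q≤p

    larger : ∀ {x} → x ∈ ⟦ a , b ⟧ → ∃[ y ] y ∈ ⟦ a , b ⟧ × K x < K y
    larger {x} x∈ with em {P = ∃[ y ] y ∈ ⟦ a , b ⟧ × K x < K y}
    ... | yes y = y
    ... | no ¬y = ⊥-elim (none (x , x∈ , λ {y} y∈ → case y y∈ (K y ≤? K x)))
      where
      case : ∀ y → y ∈ ⟦ a , b ⟧ → _ → K y ≤ K x
      case y y∈ (yes y≤x) = y≤x
      case y y∈ (no  y≰x) = ⊥-elim (¬y (y , y∈ , ≰⇒> y≰x))

    local : ∀ {x} → x ∈ ⟦ a , b ⟧ → ∃[ δ ] 0# < δ × (∀ {u v} → u ∈ ⟦ a , b ⟧ → v ∈ ⟦ a , b ⟧ →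
      u ≤ x → x ≤ v → ∣ u - x ∣ < δ → ∣ v - x ∣ < δ → Dominated u v)
    local {x} x∈ with larger x∈
    ... | y , y∈ , Kx<Ky with K-cont x∈ (x<y⇒0<y-x Kx<Ky)
    ...   | δ , 0<δ , close = δ , 0<δ , λ u∈ v∈ u≤x x≤v u-near v-near → y , y∈ , λ {w} u≤w w≤v →
      <-by (x<y⇒0<y-x (≤-<-trans (x≤∣x∣ (K w - K x))
          (close (≤-trans (proj₁ u∈) u≤w , ≤-trans w≤v (proj₂ v∈)) (between-near u≤w w≤v u-near v-near))))
           (solve 3 (λ x y w → y :- w := (y :- x) :- (w :- x)) refl (K x) (K y) (K w))

    absurd : Dominated a b → ⊥
    absurd (y , (a≤y , y≤b) , <y) = <-irrefl refl (<y a≤y y≤b)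

  -- The division-free (Fréchet) form of the derivative. Here `y` may equal `x`, which is why the
  -- bound is not strict, and errors add without any reciprocals.
  HasDerivativeAt : Pred Carrier 0ℓ → (Carrier → Carrier) → Carrier → Carrier → Set
  HasDerivativeAt D h x A = ∀ {ε} → 0# < ε → ∃[ δ ] 0# < δ ×
    (∀ {y} → y ∈ D → ∣ y - x ∣ < δ → ∣ h y - h x - A * (y - x) ∣ ≤ ε * ∣ y - x ∣)

  CongruentOn : Pred Carrier 0ℓ → (Carrier → Carrier) → Set
  CongruentOn D h = ∀ {x y} → x ∈ D → y ∈ D → x ≈ y → h x ≈ h y

  -- The relation `h u ≤ h v + ε * (v - u)` is transitive, and the derivative estimate on either
  -- side of `x` gives it for short intervals around `x`; Cousin's lemma carries it to `a` and `b`,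
  -- and `ε` tends to zero. Differentiability is relative to the closed interval, hence one-sided at
  -- its ends.
  nonneg-derivative⇒≤ : ∀ h → a ≤ b → (∀ {x} → x ∈ ⟦ a , b ⟧ →
      ∃[ A ] 0# ≤ A × HasDerivativeAt ⟦ a , b ⟧ h x A) → h a ≤ h b
  nonneg-derivative⇒≤ {a} {b} h a≤b deriv = ≤-limit limit
    where
    almost : 0# < ε → h a ≤ h b + ε * (b - a)
    almost {ε} 0<ε = cousin (λ u v → h u ≤ h v + ε * (v - u)) compose a≤b local
      where
      compose : ∀ {x y z} → h x ≤ h y + ε * (y - x) → h y ≤ h z + ε * (z - y) → h x ≤ h z + ε * (z - x)
      compose {x} {y} {z} p q = ≤-by (x≤y⇒0≤y-x p ⊕ x≤y⇒0≤y-x q)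
        (solve 7 (λ hx hy hz x y z ε → hz :+ ε :* (z :- x) :- hx := (hy :+ ε :* (y :- x) :- hx) :+
            (hz :+ ε :* (z :- y) :- hy))
          refl (h x) (h y) (h z) x y z ε)
      local : ∀ {x} → x ∈ ⟦ a , b ⟧ → ∃[ δ ] 0# < δ × (∀ {u v} → u ∈ ⟦ a , b ⟧ → v ∈ ⟦ a , b ⟧ →
        u ≤ x → x ≤ v → ∣ u - x ∣ < δ → ∣ v - x ∣ < δ → h u ≤ h v + ε * (v - u))
      local {x} x∈ with deriv x∈
      ... | A , 0≤A , hasDeriv with hasDeriv 0<ε
      ...   | δ , 0<δ , close = δ , 0<δ , λ {u} {v} u∈ v∈ u≤x x≤v u-near v-near →
        compose {u} {x} {v}
          (≤-by (x≤y⇒0≤y-x (≤-trans (x≤∣x∣ _) (close u∈ u-near)) ⊕ 0≤A ⊗ x≤y⇒0≤y-x u≤x)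
            (trans (solve 6 (λ hu hx x u A ε → hx :+ ε :* (x :- u) :- hu :=
                (ε :* (x :- u) :- (hu :- hx :- A :* (u :- x))) :+ A :* (x :- u)) refl (h u) (h x) x u A ε)
              (+-congʳ (+-congʳ (*-congˡ (sym (x≤y⇒∣x-y∣≈y-x u≤x)))))))
          (≤-by (x≤y⇒0≤y-x (≤-trans (-x≤∣x∣ _) (close v∈ v-near)) ⊕ 0≤A ⊗ x≤y⇒0≤y-x x≤v)
            (trans (solve 6 (λ hv hx x v A ε → hv :+ ε :* (v :- x) :- hx :=
                (ε :* (v :- x) :- :- (hv :- hx :- A :* (v :- x))) :+ A :* (v :- x)) refl (h v) (h x) x v A ε)
              (+-congʳ (+-congʳ (*-congˡ (sym (x≤y⇒∣y-x∣≈y-x x≤v)))))))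
    limit : 0# < ε → h a ≤ h b + ε
    limit {ε} 0<ε = case scaleSmall (x≤y⇒0≤y-x a≤b) 0<ε of λ
      (η , 0<η , bound) → ≤-trans (almost 0<η) (≤-by (x≤y⇒0≤y-x (proj₁ bound))
        (solve 5 (λ hb ε η a b → hb :+ ε :- (hb :+ η :* (b :- a)) := ε :- (b :- a) :* η) refl (h b) ε η a b))

  -- Away from `x` the quotient estimate is multiplied by `y - x`. The limit says nothing about
  -- `y ≈ x`; there congruence of `h` makes the error vanish.
  derivativeOn⇒hasDerivativeAt : ∀ {h′} → DerivativeOn D h h′ → CongruentOn D h → x ∈ D →
    HasDerivativeAt D h x (h′ x)
  derivativeOn⇒hasDerivativeAt {D} {h} {x} {h′} deriv h-cong x∈D {ε} 0<ε = case deriv x∈D 0<ε of λ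
    (δ , 0<δ , close) → δ , 0<δ , λ {y} y∈D y-near → case y ≟ x of λ
      { (yes y≈x) → ≤-respˡ-≈ (sym (trans (∣∣-cong
            (≈-mod 1# (≈-mod (- h′ x) (solve 5 (λ hy hx a y x → hy :- hx :- a :* (y :- x) := :0 :+ :1 :*
                (hy :- hx) :+ (:- a) :* (y :- x)) refl (h y) (h x) (h′ x) y x) y≈x)
              (h-cong y∈D x∈D y≈x)))
            (0≤x⇒∣x∣≈x ≤-refl)))
          (proj₁ 0<ε ⊗ 0≤∣x∣ (y - x))
      ; (no y≉x) → ≤-respˡ-≈ (∣∣-cong (sym
            (≈-mod (h x - h y) (solve 5 (λ hy hx a d r → hy :- hx :- a :* d := ((hy :- hx) :* r :- a) :* d :+
                (hx :- hy) :* (d :* r :- :1)) refl (h y) (h x) (h′ x) (y - x) ((y - x) ⁻¹))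
              (⁻¹-inverseʳ λ y-x≈0 → y≉x (≈-mod 1# (solve 2 (λ x y → y := x :+ :1 :* (y :- x :- :0))
                  refl x y) y-x≈0)))))
          (∣x*y∣≤b*∣y∣ (y - x) (proj₁ (close y∈D (y≉x⇒0<∣y-x∣ y≉x) y-near))) }

  hasDerivativeAt-resp : x ≈ y → h x ≈ h y → HasDerivativeAt D h y A → HasDerivativeAt D h x A
  hasDerivativeAt-resp {x} {y} {h} x≈y hx≈hy deriv 0<ε = case deriv 0<ε of λ
    (δ , 0<δ , close) → δ , 0<δ , λ {w} w∈D w-near →
      let w-x≈w-y = +-congˡ { w } (-‿cong x≈y) in
      ≤-respˡ-≈ (∣∣-cong (sym (+-cong (+-congˡ (-‿cong hx≈hy)) (-‿cong (*-congˡ w-x≈w-y)))))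
        (≤-respʳ-≈ (*-congˡ (∣∣-cong (sym w-x≈w-y))) (close w∈D (<-respˡ-≈ (∣∣-cong w-x≈w-y) w-near)))

  -- The two linear approximations are compared at a single point `x + m` to the right of `x`, where
  -- they differ by `(A - B) * m`, which is at most `ε * m`. Used in both directions, this is
  -- uniqueness of the derivative.
  derivative-≤ : x ∈ ⦅ a , b ⦆ → HasDerivativeAt ⦅ a , b ⦆ h x A → HasDerivativeAt ⦅ a , b ⦆ h x B → A ≤ B
  derivative-≤ {x} {a} {b} {h} {A} {B} (a<x , x<b) derivA derivB = ≤-limit λ {ε} 0<ε →
    case derivA (0<½ +⊗ 0<ε) , derivB (0<½ +⊗ 0<ε) of λ
    ((δ , 0<δ , closeA) , (δ′ , 0<δ′ , closeB)) → case minPos 0<δ 0<δ′ of λ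
    (ζ , 0<ζ , ζ≤δ , ζ≤δ′) → case minPos 0<ζ (x<y⇒0<y-x x<b) of λ
    (η , 0<η , η≤ζ , η≤b-x) →
      let m = ½ * η
          y = x + m
          0<m = 0<½ +⊗ 0<η
          y-x≈m = solve 2 (λ x m → x :+ m :- x := m) refl x m
          x<y = <-by 0<m y-x≈m
          ∣y-x∣≈m = trans (x≤y⇒∣y-x∣≈y-x (proj₁ x<y)) y-x≈m
          y∈ = <-trans a<x x<y , <-by (x<y⇒0<y-x (<-≤-trans (half< 0<η) η≤b-x))
              (solve 3 (λ x m b → b :- (x :+ m) := b :- x :- m) refl x m b)
          y-near = <-respˡ-≈ (sym ∣y-x∣≈m) (<-≤-trans (half< 0<η) η≤ζ)
      in ≤-by (*-cancelˡ-nonneg 0<m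
           (≤-respʳ-≈ (sym (≈-mod (- (½ * ε + ½ * ε)) (≈-mod (m * ε)
               (solve 9 (λ A B ε h x m d hx hy →
                   m :* (B :+ ε :- A) :=
                   (h :* ε :* d :- (:- (hy :- hx :- A :* (x :+ m :- x)))) :+
                       (h :* ε :* d :- (hy :- hx :- B :* (x :+ m :- x)))
                     :+ (:- (h :* ε :+ h :* ε)) :* (d :- m) :+ m :* ε :* (:1 :- (h :+ h)))
                 refl A B ε ½ x m ∣ y - x ∣ (h x) (h y)) (sym ½-twice)) ∣y-x∣≈m))
             (x≤y⇒0≤y-x (≤-trans (-x≤∣x∣ _) (closeA y∈ (<-≤-trans y-near ζ≤δ)))
               ⊕ x≤y⇒0≤y-x (≤-trans (x≤∣x∣ _) (closeB y∈ (<-≤-trans y-near ζ≤δ′))))))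
           refl

  -- Derivatives are given as bare functions on a setoid; that they respect _≈_ is
  -- uniqueness of the limit.
  derivative-congruent : ∀ {h′} → CongruentOn ⦅ a , b ⦆ h → DerivativeOn ⦅ a , b ⦆ h h′ →
      CongruentOn ⦅ a , b ⦆ h′
  derivative-congruent {h = h} {h′} h-cong deriv {x} {y} x∈ y∈ x≈y = antisym (derivative-≤ x∈ at-x at-y)
      (derivative-≤ x∈ at-y at-x)
    where
    at-x : HasDerivativeAt ⦅ _ , _ ⦆ h x (h′ x)
    at-x = derivativeOn⇒hasDerivativeAt {h′ = h′} deriv h-cong x∈
    at-y : HasDerivativeAt ⦅ _ , _ ⦆ h x (h′ y)
    at-y = hasDerivativeAt-resp x≈y (h-cong x∈ y∈ x≈y) (derivativeOn⇒hasDerivativeAt {h′ = h′} deriv h-cong y∈)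

  hasDerivativeAt-+ : HasDerivativeAt D h x A → HasDerivativeAt D k x B →
    HasDerivativeAt D (λ y → h y + k y) x (A + B)
  hasDerivativeAt-+ {h = h} {x} {A} {k} {B} derivA derivB {ε} 0<ε =
    case derivA (0<½ +⊗ 0<ε) , derivB (0<½ +⊗ 0<ε) of λ
    ((δ , 0<δ , closeA) , (δ′ , 0<δ′ , closeB)) → case minPos 0<δ 0<δ′ of λ
    (η , 0<η , η≤δ , η≤δ′) → η , 0<η , λ {y} y∈D y-near →
      let p = h y - h x - A * (y - x)
          q = k y - k x - B * (y - x)
          p≤ = closeA y∈D (<-≤-trans y-near η≤δ)
          q≤ = closeB y∈D (<-≤-trans y-near η≤δ′)
      in ≤-respˡ-≈ (∣∣-cong (solve 7 (λ hy hx A d ky kx B → (hy :- hx :- A :* d) :+ (ky :- kx :- B :* d) :=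
          (hy :+ ky) :- (hx :+ kx) :- (A :+ B) :* d)
             refl (h y) (h x) A (y - x) (k y) (k x) B))
           (≤-trans (∣x+y∣≤∣x∣+∣y∣ p q)
             (≤-by (x≤y⇒0≤y-x p≤ ⊕ x≤y⇒0≤y-x q≤)
               (≈-mod (ε * ∣ y - x ∣) (solve 5 (λ ε d h p q → ε :* d :- (p :+ q) := (h :* ε :* d :- p) :+
                   (h :* ε :* d :- q) :+ ε :* d :* (:1 :- (h :+ h))) refl ε (∣ y - x ∣) ½ (∣ p ∣) (∣ q ∣))
                 (sym ½-twice))))

  -- A chain rule for translations and reflections: these are isometries, so `δ` and `ε` carry over
  -- unchanged.
  hasDerivativeAt-∘ : ∀ {α} → (∀ {y} → y ∈ D → α y ∈ E) → (∀ y → α y - α x ≈ c * (y - x)) →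
      (∀ y → ∣ α y - α x ∣ ≈ ∣ y - x ∣) →
    HasDerivativeAt E h (α x) A → HasDerivativeAt D (h ∘ α) x (A * c)
  hasDerivativeAt-∘ {x = x} {c} {h} {A} {α} D⇒E affine isometric deriv {ε} 0<ε = case deriv 0<ε of λ
    (δ , 0<δ , close) → δ , 0<δ , λ {y} y∈D y-near →
      ≤-respˡ-≈ (∣∣-cong (≈-mod (- A) (solve 6 (λ hy hx A d c e → hy :- hx :- A :* d :=
          hy :- hx :- A :* c :* e :+ (:- A) :* (d :- c :* e))
          refl (h (α y)) (h (α x)) A (α y - α x) c (y - x)) (affine y)))
        (≤-respʳ-≈ (*-congˡ (isometric y)) (close (D⇒E y∈D) (<-respˡ-≈ (sym (isometric y)) y-near)))

  hasDerivativeAt-translate : (∀ {u} → u ∈ D → y + u ∈ E) → HasDerivativeAt E h (y + x) A → HasDerivativeAt D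
      (λ u → h (y + u)) x (A * 1#)
  hasDerivativeAt-translate {y = y} {x = x} D⇒E = hasDerivativeAt-∘ D⇒E
    (λ u → solve 3 (λ u x y → y :+ u :- (y :+ x) := :1 :* (u :- x)) refl u x y)
    (λ u → ∣∣-cong (solve 3 (λ u x y → y :+ u :- (y :+ x) := u :- x) refl u x y))

  hasDerivativeAt-reflect : (∀ {u} → u ∈ D → y - u ∈ E) → HasDerivativeAt E h (y - x) A → HasDerivativeAt D
      (λ u → h (y - u)) x (A * - 1#)
  hasDerivativeAt-reflect {y = y} {x = x} D⇒E = hasDerivativeAt-∘ D⇒E
    (λ u → solve 3 (λ u x y → y :- u :- (y :- x) := (:- :1) :* (u :- x)) refl u x y)
    (λ u → trans (∣∣-cong (solve 3 (λ u x y → y :- u :- (y :- x) := x :- u) refl u x y)) (∣x-y∣≈∣y-x∣ x u))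

  hasDerivativeAt-square : ∀ c → HasDerivativeAt D (λ y → c * (y * y)) x (c * (x + x))
  hasDerivativeAt-square {x = x} c {ε} 0<ε = case scaleSmall (0≤∣x∣ c) 0<ε of λ
    (δ , 0<δ , cδ<ε) → δ , 0<δ , λ {y} _ y-near →
      ≤-respˡ-≈ (∣∣-cong (solve 3 (λ c x y → c :* (y :- x) :* (y :- x) := c :* (y :* y) :- c :* (x :* x) :- c :*
          (x :+ x) :* (y :- x)) refl c x y))
        (∣x*y∣≤b*∣y∣ (y - x) (≤-trans (∣x*y∣≤b*∣y∣ (y - x) ≤-refl)
          (≤-trans (≤-by (0≤∣x∣ c ⊗ x≤y⇒0≤y-x (proj₁ y-near))
              (solve 3 (λ c d e → c :* d :- c :* e := c :* (d :- e)) refl (∣ c ∣) δ (∣ y - x ∣)))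
              (proj₁ cδ<ε))))

  -- L bounds from below the second symmetric derivative of h at x; this tests
  -- second-order behaviour without a derivative of h itself.
  SymmetricLowerAt : Pred Carrier 0ℓ → (Carrier → Carrier) → Carrier → Carrier → Set
  SymmetricLowerAt D h x L = ∀ {ε} → 0# < ε → ∃[ δ ] 0# < δ ×
    (∀ {y z} → y ∈ D → z ∈ D → y + z ≈ x + x → ∣ y - x ∣ < δ →
      (L - ε) * ((y - x) * (y - x)) ≤ h y + h z - (h x + h x))

  -- The function `h (x + u) + h (x - u)` of `u` has derivative `h′ (x + u) - h′ (x - u)`, which by
  -- the expansion of `h′` at `x` is at least `(L - ε) * (u + u)` for small `u ≥ 0`. Subtracting
  -- `(L - ε) * (u * u)` therefore leaves a nondecreasing function, `ψ`, whose values at `0#` and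
  -- `ρ` are compared.
  second-derivative⇒symmetricLowerAt : ∀ {h′} → CongruentOn ⟦ a , b ⟧ h → DerivativeOn ⦅ a , b ⦆ h h′ →
    x ∈ ⦅ a , b ⦆ → HasDerivativeAt ⦅ a , b ⦆ h′ x L → SymmetricLowerAt ⟦ a , b ⟧ h x L
  second-derivative⇒symmetricLowerAt {a} {b} {h} {x} {L} {h′} h-cong deriv (a<x , x<b) deriv′ {ε} 0<ε =
      case deriv′ 0<ε of λ
    (δ′ , 0<δ′ , close) → case minPos (x<y⇒0<y-x a<x) (x<y⇒0<y-x x<b) of λ
    (r , 0<r , r≤x-a , r≤b-x) → case minPos 0<δ′ 0<r of λ
    (δ , 0<δ , δ≤δ′ , δ≤r) → δ , 0<δ , λ {y} {z} y∈ z∈ y+z≈2x y-near → case total x y of λ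
      { (inj₁ x≤y) → right x (≤-trans δ≤r r≤x-a) (≤-trans δ≤r r≤b-x)
              (λ p q → close p (<-≤-trans q δ≤δ′)) y∈ z∈ y+z≈2x y-near x≤y
      -- The points `y` and `z` are mirror images in `x`, so here `z` lies on the right and takes
      -- the place of `y`.
      ; (inj₂ y≤x) → ≤-respˡ-≈ (≈-mod ((L - ε) * (z - y))
              (solve 4 (λ x y z l → l :* ((z :- x) :* (z :- x)) := l :* ((y :- x) :* (y :- x)) :+ l :*
              (z :- y) :* (y :+ z :- (x :+ x))) refl x y z (L - ε)) y+z≈2x)
          (≤-respʳ-≈ (+-congʳ (solve 2 (λ y z → z :+ y := y :+ z) refl (h y) (h z)))
            (right x (≤-trans δ≤r r≤x-a) (≤-trans δ≤r r≤b-x) (λ p q → close p (<-≤-trans q δ≤δ′)) z∈ y∈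
              (trans (solve 2 (λ y z → z :+ y := y :+ z) refl y z) y+z≈2x)
              (<-respˡ-≈ (trans (∣x-y∣≈∣y-x∣ y x) (∣∣-cong
                  (≈-mod (- 1#) (solve 3 (λ x y z → x :- y := z :- x :+ (:- :1) :* (y :+ z :- (x :+ x)))
                  refl x y z) y+z≈2x))) y-near)
              (≤-by (x≤y⇒0≤y-x y≤x) (≈-mod 1# (solve 3
                  (λ x y z → z :- x := x :- y :+ :1 :* (y :+ z :- (x :+ x))) refl x y z) y+z≈2x)))) }
    where
    right : ∀ x {δ y z} → δ ≤ x - a → δ ≤ b - x →
      (∀ {y} → y ∈ ⦅ a , b ⦆ → ∣ y - x ∣ < δ → ∣ h′ y - h′ x - L * (y - x) ∣ ≤ ε * ∣ y - x ∣) →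
      y ∈ ⟦ a , b ⟧ → z ∈ ⟦ a , b ⟧ → y + z ≈ x + x → ∣ y - x ∣ < δ → x ≤ y →
      (L - ε) * ((y - x) * (y - x)) ≤ h y + h z - (h x + h x)
    right x {δ} {y} {z} δ≤x-a δ≤b-x close y∈ z∈ y+z≈2x y-near x≤y =
      ≤-by (x≤y⇒0≤y-x (nonneg-derivative⇒≤ ψ 0≤ρ ψ-deriv)) ψ-increment
      where
      ρ l : Carrier
      ρ = y - x
      l = L - ε
      ψ : Carrier → Carrier
      ψ u = h (x + u) + h (x - u) + (- l) * (u * u)
      0≤ρ : 0# ≤ ρ
      0≤ρ = x≤y⇒0≤y-x x≤y
      ρ<δ : ρ < δ
      ρ<δ = <-respˡ-≈ (x≤y⇒∣y-x∣≈y-x x≤y) y-near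

      right∈ : u ∈ ⟦ 0# , ρ ⟧ → x + u ∈ ⦅ a , b ⦆
      right∈ {u} (0≤u , u≤ρ) =
        <-by (x<y⇒0<y-x (<-≤-trans (≤-<-trans u≤ρ ρ<δ) δ≤x-a) +⊕ 0≤u +⊕ 0≤u)
            (solve 3 (λ a x u → x :+ u :- a := x :- a :- u :+ u :+ u) refl a x u) ,
        <-by (x<y⇒0<y-x (<-≤-trans (≤-<-trans u≤ρ ρ<δ) δ≤b-x)) (solve 3 (λ b x u → b :- (x :+ u) := b :- x :- u)
            refl b x u)
      left∈ : u ∈ ⟦ 0# , ρ ⟧ → x - u ∈ ⦅ a , b ⦆
      left∈ {u} (0≤u , u≤ρ) =
        <-by (x<y⇒0<y-x (<-≤-trans (≤-<-trans u≤ρ ρ<δ) δ≤x-a)) (solve 3 (λ a x u → x :- u :- a := x :- a :- u)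
            refl a x u) ,
        <-by (x<y⇒0<y-x (<-≤-trans (≤-<-trans u≤ρ ρ<δ) δ≤b-x) +⊕ 0≤u +⊕ 0≤u)
            (solve 3 (λ b x u → b :- (x :- u) := b :- x :- u :+ u :+ u) refl b x u)

      open-cong : CongruentOn ⦅ a , b ⦆ h
      open-cong (a<p , p<b) (a<q , q<b) = h-cong (proj₁ a<p , proj₁ p<b) (proj₁ a<q , proj₁ q<b)
      closed : ∀ {p} → p ∈ ⦅ a , b ⦆ → p ∈ ⟦ a , b ⟧
      closed (a<p , p<b) = proj₁ a<p , proj₁ p<b
      h-deriv : ∀ {p} → p ∈ ⦅ a , b ⦆ → HasDerivativeAt ⦅ a , b ⦆ h p (h′ p)
      h-deriv = derivativeOn⇒hasDerivativeAt {h′ = h′} deriv open-cong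

      ψ-deriv : u ∈ ⟦ 0# , ρ ⟧ → ∃[ A ] 0# ≤ A × HasDerivativeAt ⟦ 0# , ρ ⟧ ψ u A
      ψ-deriv {u} u∈@(0≤u , u≤ρ) = h′ (x + u) * 1# + h′ (x - u) * - 1# + (- l) * (u + u) ,
        ≤-respʳ-≈ slope≈ (x≤y⇒0≤y-x (≤-trans (-x≤∣x∣ _)
            (close (right∈ u∈) (<-respˡ-≈ (sym ∣right∣) (≤-<-trans u≤ρ ρ<δ))))
          ⊕ x≤y⇒0≤y-x (≤-trans (x≤∣x∣ _) (close (left∈ u∈) (<-respˡ-≈ (sym ∣left∣) (≤-<-trans u≤ρ ρ<δ))))) ,
        hasDerivativeAt-+ (hasDerivativeAt-+ (hasDerivativeAt-translate right∈ (h-deriv (right∈ u∈)))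
          (hasDerivativeAt-reflect left∈ (h-deriv (left∈ u∈)))) (hasDerivativeAt-square (- l))
        where
        ∣right∣ : ∣ x + u - x ∣ ≈ u
        ∣right∣ = trans (∣∣-cong (solve 2 (λ x u → x :+ u :- x := u) refl x u)) (0≤x⇒∣x∣≈x 0≤u)
        ∣left∣ : ∣ x - u - x ∣ ≈ u
        ∣left∣ = trans (∣∣-cong (solve 2 (λ x u → x :- u :- x := :- u) refl x u))
            (trans (∣-x∣≈∣x∣ u) (0≤x⇒∣x∣≈x 0≤u))
        slope≈ : (ε * ∣ x + u - x ∣ - - (h′ (x + u) - h′ x - L * (x + u - x))) +
            (ε * ∣ x - u - x ∣ - (h′ (x - u) - h′ x - L * (x - u - x)))
          ≈ h′ (x + u) * 1# + h′ (x - u) * - 1# + (- l) * (u + u)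
        slope≈ = ≈-mod ε (≈-mod ε (solve 9 (λ ε m n hr hl hx L x u →
            (ε :* m :- (:- (hr :- hx :- L :* (x :+ u :- x)))) :+ (ε :* n :- (hl :- hx :- L :* (x :- u :- x))) :=
            hr :* :1 :+ hl :* (:- :1) :+ (:- (L :- ε)) :* (u :+ u) :+ ε :* (m :- u) :+ ε :* (n :- u))
          refl ε (∣ x + u - x ∣) (∣ x - u - x ∣) (h′ (x + u)) (h′ (x - u)) (h′ x) L x u) ∣left∣) ∣right∣

      0∈ : 0# ∈ ⟦ 0# , ρ ⟧
      0∈ = ≤-refl , 0≤ρ
      ρ∈ : ρ ∈ ⟦ 0# , ρ ⟧
      ρ∈ = 0≤ρ , ≤-refl

      x∈ : x ∈ ⟦ a , b ⟧
      x∈ = ≤-by (x≤y⇒0≤y-x (proj₁ (closed (left∈ 0∈)))) (solve 2 (λ x a → x :- a := x :- :0 :- a) refl x a) ,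
           ≤-by (x≤y⇒0≤y-x (proj₂ (closed (left∈ 0∈)))) (solve 2 (λ x b → b :- x := b :- (x :- :0)) refl x b)

      ψ-increment : h y + h z - (h x + h x) - l * (ρ * ρ) ≈ ψ ρ - ψ 0#
      ψ-increment = ≈-mod 1# (≈-mod 1# (≈-mod (- 1#) (≈-mod (- 1#) (solve 9 (λ hy hz hx p q r s l ρ →
          hy :+ hz :- (hx :+ hx) :- l :* (ρ :* ρ) :=
          (p :+ q :+ (:- l) :* (ρ :* ρ)) :- (r :+ s :+ (:- l) :* (:0 :* :0))
            :+ :1 :* (hy :- p) :+ :1 :* (hz :- q) :+ (:- :1) :* (hx :- r) :+ (:- :1) :* (hx :- s))
        refl (h y) (h z) (h x) (h (x + ρ)) (h (x - ρ)) (h (x + 0#)) (h (x - 0#)) l ρ)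
        (h-cong x∈ (closed (left∈ 0∈)) (solve 1 (λ x → x := x :- :0) refl x)))
        (h-cong x∈ (closed (right∈ 0∈)) (solve 1 (λ x → x := x :+ :0) refl x)))
        (h-cong z∈ (closed (left∈ ρ∈)) (≈-mod 1# (solve 3
            (λ x y z → z := x :- (y :- x) :+ :1 :* (y :+ z :- (x :+ x))) refl x y z) y+z≈2x)))
        (h-cong y∈ (closed (right∈ ρ∈)) (solve 2 (λ x y → y := x :+ (y :- x)) refl x y))

  -- Calculus of symmetric second differences.

  symmetricLowerAt-mono : M ≤ L → SymmetricLowerAt D h x L → SymmetricLowerAt D h x M
  symmetricLowerAt-mono {M} {L} {x = x} M≤L lower {ε} 0<ε = case lower 0<ε of λ
    (δ , 0<δ , bound) → δ , 0<δ , λ {y} {z} y∈ z∈ y+z≈2x y-near →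
      ≤-trans (≤-by (x≤y⇒0≤y-x M≤L ⊗ sq-nonneg (y - x))
        (solve 4 (λ M L ε v → (L :- ε) :* (v :* v) :- (M :- ε) :* (v :* v) := (L :- M) :* (v :* v))
            refl M L ε (y - x)))
        (bound y∈ z∈ y+z≈2x y-near)

  symmetricLowerAt-const : (∀ {y} → y ∈ D → h y ≈ h x) → L ≤ 0# → SymmetricLowerAt D h x L
  symmetricLowerAt-const {h = h} {x} {L} const L≤0 {ε} 0<ε = 1# , 0<1 , λ {y} {z} y∈ z∈ _ _ →
    ≤-by ((x≤y⇒0≤y-x L≤0 ⊕ proj₁ 0<ε) ⊗ sq-nonneg (y - x))
      (≈-mod 1# (≈-mod 1# (solve 6 (λ hx hy hz L ε v → hy :+ hz :- (hx :+ hx) :- (L :- ε) :* (v :* v) :=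
          (:0 :- L :+ ε) :* (v :* v) :+ :1 :* (hy :- hx) :+ :1 :* (hz :- hx))
        refl (h x) (h y) (h z) L ε (y - x)) (const z∈)) (const y∈))

  symmetricLowerAt-+ : SymmetricLowerAt D h x L → SymmetricLowerAt D k x M →
    SymmetricLowerAt D (λ y → h y + k y) x (L + M)
  symmetricLowerAt-+ {h = h} {x} {L} {k} {M} lowerL lowerM {ε} 0<ε =
    case lowerL (0<½ +⊗ 0<ε) , lowerM (0<½ +⊗ 0<ε) of λ
    ((δ , 0<δ , boundL) , (δ′ , 0<δ′ , boundM)) → case minPos 0<δ 0<δ′ of λ
    (η , 0<η , η≤δ , η≤δ′) → η , 0<η , λ {y} {z} y∈ z∈ y+z≈2x y-near →
      ≤-by (x≤y⇒0≤y-x (boundL y∈ z∈ y+z≈2x (<-≤-trans y-near η≤δ)) ⊕ x≤y⇒0≤y-x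
          (boundM y∈ z∈ y+z≈2x (<-≤-trans y-near η≤δ′)))
        (≈-mod (ε * ((y - x) * (y - x))) (solve 11 (λ hy hz a ky kz b L M v ε h →
            (hy :+ ky :+ (hz :+ kz)) :- (a :+ b :+ (a :+ b)) :- (L :+ M :- ε) :* v :=
            (hy :+ hz :- (a :+ a) :- (L :- h :* ε) :* v) :+
                (ky :+ kz :- (b :+ b) :- (M :- h :* ε) :* v) :+ ε :* v :* (:1 :- (h :+ h))) refl
          (h y) (h z) (h x) (k y) (k z) (k x) L M ((y - x) * (y - x)) ε ½) (sym ½-twice))

  symmetricLowerAt-sum : {h : Fin n → Carrier → Carrier} {L : Fin n → Carrier} →
    (∀ i → SymmetricLowerAt D (h i) x (L i)) → SymmetricLowerAt D (λ y → sum (λ i → h i y)) x (sum L)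
  symmetricLowerAt-sum {zero}  lower = symmetricLowerAt-const (λ _ → refl) ≤-refl
  symmetricLowerAt-sum {suc n} {h = h} lower = symmetricLowerAt-+
    {h = h zero} {k = λ y → sum (λ i → h (suc i) y)} (lower zero) (symmetricLowerAt-sum {h = h ∘ suc} (lower ∘ suc))

  -- An affine map keeps `y` and `z` symmetric about the base point and multiplies the squared step
  -- by `d * d`; the tolerances are rescaled accordingly, `ε` by `d * d` and `δ` by `∣ d ∣`.
  symmetricLowerAt-∘ : ∀ {α} → (∀ {y} → y ∈ D → α y ∈ E) → (∀ y → α y - α x ≈ d * (y - x)) →
    SymmetricLowerAt E h (α x) L → SymmetricLowerAt D (h ∘ α) x (L * (d * d))
  symmetricLowerAt-∘ {x = x} {d} {h} {L} {α} D⇒E affine lower {ε} 0<ε = case scaleSmall (sq-nonneg d) 0<ε of λ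
    (ε′ , 0<ε′ , ddε′<ε) → case lower 0<ε′ of λ
    (δ′ , 0<δ′ , bound) → case scaleSmall (0≤∣x∣ d) 0<δ′ of λ
    (δ , 0<δ , dδ<δ′) → δ , 0<δ , λ {y} {z} y∈ z∈ y+z≈2x y-near →
      ≤-trans
        (≤-by (x≤y⇒0≤y-x (proj₁ ddε′<ε) ⊗ sq-nonneg (y - x))
          (≈-mod ((L - ε′) * (α y - α x + d * (y - x))) (solve 6 (λ L ε ε′ d e v →
             (L :- ε′) :* (e :* e) :- (L :* (d :* d) :- ε) :* (v :* v) := (ε :- d :* d :* ε′) :* (v :* v) :+
                 (L :- ε′) :* (e :+ d :* v) :* (e :- d :* v))
             refl L ε ε′ d (α y - α x) (y - x)) (affine y)))
        (bound (D⇒E y∈) (D⇒E z∈)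
          (≈-mod 1# (≈-mod 1# (≈-mod d (solve 7 (λ p q a d x y z → p :+ q := a :+ a :+ :1 :*
              (p :- a :- d :* (y :- x)) :+ :1 :* (q :- a :- d :* (z :- x)) :+ d :* (y :+ z :- (x :+ x)))
            refl (α y) (α z) (α x) d x y z) y+z≈2x) (affine z)) (affine y))
          (≤-<-trans (≤-trans (≤-respˡ-≈ (∣∣-cong (sym (affine y))) (∣x*y∣≤b*∣y∣ (y - x) ≤-refl))
            (≤-by (0≤∣x∣ d ⊗ x≤y⇒0≤y-x (proj₁ y-near)) (solve 3 (λ c d e → c :* d :- c :* e := c :* (d :- e))
                refl (∣ d ∣) δ (∣ y - x ∣)))) dδ<δ′))

  -- Continuity, and the chord criterion.

  lipschitz⇒continuousOn : 0# ≤ c → (∀ {x y} → x ∈ D → y ∈ D → ∣ h y - h x ∣ ≤ c * ∣ y - x ∣) → ContinuousOn D h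
  lipschitz⇒continuousOn {c} 0≤c lipschitz {x} x∈ 0<ε = case scaleSmall 0≤c 0<ε of λ
    (δ , 0<δ , cδ<ε) → δ , 0<δ , λ {y} y∈ y-near → ≤-<-trans (lipschitz x∈ y∈) (≤-<-trans
      (≤-by (0≤c ⊗ x≤y⇒0≤y-x (proj₁ y-near)) (solve 3 (λ c d e → c :* d :- c :* e := c :* (d :- e))
          refl c δ (∣ y - x ∣))) cδ<ε)

  continuousOn-+ : ContinuousOn D h → ContinuousOn D k → ContinuousOn D (λ y → h y + k y)
  continuousOn-+ {h = h} {k} h-cont k-cont {x} x∈ {ε} 0<ε = case h-cont x∈ (0<½ +⊗ 0<ε) , k-cont x∈
      (0<½ +⊗ 0<ε) of λ
    ((δ , 0<δ , h-close) , (δ′ , 0<δ′ , k-close)) → case minPos 0<δ 0<δ′ of λ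
    (η , 0<η , η≤δ , η≤δ′) → η , 0<η , λ {y} y∈ y-near → ≤-<-trans
      (≤-respˡ-≈ (∣∣-cong (solve 4 (λ p q r s → (p :- q) :+ (r :- s) := (p :+ r) :- (q :+ s))
          refl (h y) (h x) (k y) (k x)))
        (∣x+y∣≤∣x∣+∣y∣ (h y - h x) (k y - k x)))
      (<-by (x<y⇒0<y-x (h-close y∈ (<-≤-trans y-near η≤δ)) +⊕ x≤y⇒0≤y-x
          (proj₁ (k-close y∈ (<-≤-trans y-near η≤δ′))))
        (≈-mod ε (solve 4 (λ ε p q h → ε :- (p :+ q) := (h :* ε :- p) :+ (h :* ε :- q) :+ ε :* (:1 :- (h :+ h)))
            refl ε (∣ h y - h x ∣) (∣ k y - k x ∣) ½) (sym ½-twice)))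

  continuousOn-∘ : ∀ {α} → (∀ {y} → y ∈ D → α y ∈ E) → ContinuousOn D α → ContinuousOn E h → ContinuousOn D
      (h ∘ α)
  continuousOn-∘ D⇒E α-cont h-cont x∈ 0<ε = case h-cont (D⇒E x∈) 0<ε of λ
    (δ′ , 0<δ′ , h-close) → case α-cont x∈ 0<δ′ of λ
    (δ , 0<δ , α-close) → δ , 0<δ , λ {y} y∈ y-near → h-close (D⇒E y∈) (α-close y∈ y-near)

  continuousOn-affine : ∀ {α} → (∀ x y → α y - α x ≈ d * (y - x)) → ContinuousOn D α
  continuousOn-affine {d} affine = lipschitz⇒continuousOn (0≤∣x∣ d)
    λ {x} {y} _ _ → ≤-respˡ-≈ (∣∣-cong (sym (affine x y))) (∣x*y∣≤b*∣y∣ (y - x) ≤-refl)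

  continuousOn-sum : {h : Fin n → Carrier → Carrier} → (∀ i → ContinuousOn D (h i)) → ContinuousOn D
      (λ y → sum (λ i → h i y))
  continuousOn-sum {zero}  cont = continuousOn-affine {d = 0#} λ x y → solve 2
      (λ x y → :0 :- :0 := :0 :* (y :- x)) refl x y
  continuousOn-sum {suc n} {h = h} cont = continuousOn-+ {h = h zero} {k = λ y → sum (λ i → h (suc i) y)}
    (cont zero) (continuousOn-sum {h = h ∘ suc} (cont ∘ suc))

  continuousOn⇒congruentOn : ContinuousOn D h → CongruentOn D h
  continuousOn⇒congruentOn {D} {h} h-cont x∈ y∈ x≈y = antisym (≤-limit (close y∈ x∈ (sym x≈y)))
      (≤-limit (close x∈ y∈ x≈y))
    where
    close : x ∈ D → y ∈ D → x ≈ y → 0# < ε → h y ≤ h x + ε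
    close {x} {y} {ε} x∈ y∈ x≈y 0<ε = case h-cont x∈ 0<ε of λ
      (δ , 0<δ , near) → ≤-by (x≤y⇒0≤y-x (≤-trans (x≤∣x∣ (h y - h x))
          (proj₁ (near y∈ (<-respˡ-≈ (sym (y≈x⇒∣y-x∣≈0 (sym x≈y))) 0<δ)))))
        (solve 3 (λ hx hy ε → hx :+ ε :- hy := ε :- (hy :- hx)) refl (h x) (h y) ε)

  -- The secant slope `c * (y + x) - d` is bounded by `c + c + ∣ d ∣` on the unit interval, which is
  -- the Lipschitz constant.
  continuousOn-quadratic : 0# ≤ c → ContinuousOn ⟦ 0# , 1# ⟧ (λ t → c * (t * t) - d * t)
  continuousOn-quadratic {c} {d} 0≤c = lipschitz⇒continuousOn {c = c + c + ∣ d ∣}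
      (0≤c ⊕ 0≤c ⊕ 0≤∣x∣ d) λ {x} {y} (0≤x , x≤1) (0≤y , y≤1) →
    ≤-respˡ-≈ (∣∣-cong (solve 4 (λ c d x y → (c :* (y :+ x) :- d) :* (y :- x) := c :* (y :* y) :- d :* y :-
        (c :* (x :* x) :- d :* x)) refl c d x y))
      (∣x*y∣≤b*∣y∣ (y - x) (∣∣-lub
        (≤-by (0≤c ⊗ x≤y⇒0≤y-x x≤1 ⊕ 0≤c ⊗ x≤y⇒0≤y-x y≤1 ⊕ x≤y⇒0≤y-x (-x≤∣x∣ d))
          (solve 5 (λ c d x y m → c :+ c :+ m :- (c :* (y :+ x) :- d) := c :* (:1 :- x) :+ c :* (:1 :- y) :+
              (m :- (:- d))) refl c d x y (∣ d ∣)))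
        (≤-by (0≤c ⊕ 0≤c ⊕ 0≤c ⊗ 0≤x ⊕ 0≤c ⊗ 0≤y ⊕ x≤y⇒0≤y-x (x≤∣x∣ d))
          (solve 5 (λ c d x y m → c :+ c :+ m :- (:- (c :* (y :+ x) :- d)) := c :+ c :+ c :* x :+ c :* y :+
              (m :- d)) refl c d x y (∣ d ∣)))))

  -- If G exceeded its chord by η at s, then G minus the chord plus η t² would have
  -- an interior maximum, where its second symmetric derivative is at least 2η.
  symmetricLower⇒below-chord : ∀ G → ContinuousOn ⟦ 0# , 1# ⟧ G →
      (∀ {c} → c ∈ ⦅ 0# , 1# ⦆ → SymmetricLowerAt ⟦ 0# , 1# ⟧ G c 0#) →
    ∀ {s} → s ∈ ⟦ 0# , 1# ⟧ → G s ≤ s * G 1# + (1# - s) * G 0#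
  symmetricLower⇒below-chord G G-cont lower {s} s∈@(0≤s , s≤1) = case G s ≤? (s * G 1# + (1# - s) * G 0#) of λ
    { (yes below) → below ; (no above) → ⊥-elim (absurd (x<y⇒0<y-x (≰⇒> above))) }
    where
    η m : Carrier
    η = G s - (s * G 1# + (1# - s) * G 0#)
    m = G 1# - G 0#
    -- The excess `η` doubles as the curvature: `K s - K 0#` is `η + η * (s * s)` and `K s - K 1#`
    -- is `η * (s * s)`, so the added convexity still leaves both endpoint values below `K s`.
    K : Carrier → Carrier
    K t = G t + (η * (t * t) - m * t)
    0∈ : 0# ∈ ⟦ 0# , 1# ⟧
    0∈ = ≤-refl , proj₁ 0<1
    1∈ : 1# ∈ ⟦ 0# , 1# ⟧
    1∈ = proj₁ 0<1 , ≤-refl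

    K-cont : 0# < η → ContinuousOn ⟦ 0# , 1# ⟧ K
    K-cont 0<η = continuousOn-+ {k = λ t → η * (t * t) - m * t} G-cont (continuousOn-quadratic (proj₁ 0<η))

    0<s : 0# < η → 0# < s
    0<s (_ , 0≉η) = 0≤s , λ 0≈s → 0≉η (sym (≈-mod (G 0# - G 1#)
        (≈-mod 1# (solve 4 (λ s g g0 g1 → g :- (s :* g1 :+ (:1 :- s) :* g0) := :0 :+ (g0 :- g1) :*
        (s :- :0) :+ :1 :* (g :- g0))
      refl s (G s) (G 0#) (G 1#)) (continuousOn⇒congruentOn G-cont s∈ 0∈ (sym 0≈s))) (sym 0≈s)))

    K0<Ks : 0# < η → K 0# < K s
    K0<Ks 0<η = <-by (0<η +⊕ proj₁ 0<η ⊗ sq-nonneg s) (solve 4 (λ s g g0 g1 →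
      let η = g :- (s :* g1 :+ (:1 :- s) :* g0) ; m = g1 :- g0 in
      (g :+ (η :* (s :* s) :- m :* s)) :- (g0 :+ (η :* (:0 :* :0) :- m :* :0)) := η :+ η :* (s :* s))
          refl s (G s) (G 0#) (G 1#))

    K1<Ks : 0# < η → K 1# < K s
    K1<Ks 0<η = <-by (0<η +⊗ (0<s 0<η +⊗ 0<s 0<η)) (solve 4 (λ s g g0 g1 →
      let η = g :- (s :* g1 :+ (:1 :- s) :* g0) ; m = g1 :- g0 in
      (g :+ (η :* (s :* s) :- m :* s)) :- (g1 :+ (η :* (:1 :* :1) :- m :* :1)) := η :* (s :* s))
          refl s (G s) (G 0#) (G 1#))

    -- The lower bound is used with tolerance `η′`: the quadratic adds twice `η′ * (u * u)` to the
    -- second difference and the tolerance costs only once that amount, so the difference at a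
    -- maximum would be positive.
    no-interior-maximum : ∀ η′ {c} → 0# < η′ → c ∈ ⦅ 0# , 1# ⦆ →
      (∀ {y} → y ∈ ⟦ 0# , 1# ⟧ → G y + (η′ * (y * y) - m * y) ≤ G c + (η′ * (c * c) - m * c)) → ⊥
    no-interior-maximum η′ {c} 0<η′ c∈@(0<c , c<1) c-max = case lower c∈ 0<η′ of λ
      (δ , 0<δ , bound) → case minPos 0<c (x<y⇒0<y-x c<1) of λ
      (r , 0<r , r≤c , r≤1-c) → case minPos 0<δ 0<r of λ
      (ρ , 0<ρ , ρ≤δ , ρ≤r) →
        let u = ½ * ρ
            0<u = 0<½ +⊗ 0<ρ
            u≤r = ≤-trans (proj₁ (half< 0<ρ)) ρ≤r
            y-c≈u = solve 2 (λ c u → c :+ u :- c := u) refl c u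
            y∈ = proj₁ (0<c +⊕ proj₁ 0<u) , ≤-by (x≤y⇒0≤y-x (≤-trans u≤r r≤1-c))
                (solve 2 (λ c u → :1 :- (c :+ u) := :1 :- c :- u) refl c u)
            z∈ = x≤y⇒0≤y-x (≤-trans u≤r r≤c) , ≤-by (x≤y⇒0≤y-x (proj₁ c<1) ⊕ proj₁ 0<u)
                (solve 2 (λ c u → :1 :- (c :- u) := :1 :- c :+ u) refl c u)
        in <⇒≱ (0<η′ +⊗ (0<u +⊗ 0<u))
          (≤-by (x≤y⇒0≤y-x (c-max y∈) ⊕ x≤y⇒0≤y-x (c-max z∈) ⊕ x≤y⇒0≤y-x
              (bound y∈ z∈ (solve 2 (λ c u → c :+ u :+ (c :- u) := c :+ c) refl c u)
              (<-respˡ-≈ (sym (trans (∣∣-cong y-c≈u) (0≤x⇒∣x∣≈x (proj₁ 0<u)))) (<-≤-trans (half< 0<ρ) ρ≤δ))))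
            (solve 7 (λ η c m u gy gz gc →
                :0 :- η :* (u :* u) :=
                ((gc :+ (η :* (c :* c) :- m :* c)) :- (gy :+ (η :* ((c :+ u) :* (c :+ u)) :- m :* (c :+ u))))
                :+ ((gc :+ (η :* (c :* c) :- m :* c)) :- (gz :+ (η :* ((c :- u) :* (c :- u)) :- m :* (c :- u))))
                :+ (gy :+ gz :- (gc :+ gc) :- (:0 :- η) :* ((c :+ u :- c) :* (c :+ u :- c))))
              refl η′ c m u (G (c + u)) (G (c - u)) (G c)))

    absurd : 0# < η → ⊥
    absurd 0<η = case maximum K (K-cont 0<η) (proj₁ 0<1) of λ
      (c , c∈@(0≤c , c≤1) , c-max) →
        let K-cong = continuousOn⇒congruentOn (K-cont 0<η)
            0<c = 0≤c , λ 0≈c → <⇒≱ (K0<Ks 0<η) (≤-respʳ-≈ (K-cong c∈ 0∈ (sym 0≈c)) (c-max s∈))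
            c<1 = c≤1 , λ c≈1 → <⇒≱ (K1<Ks 0<η) (≤-respʳ-≈ (K-cong c∈ 1∈ c≈1) (c-max s∈))
        in no-interior-maximum η 0<η (0<c , c<1) c-max

-- Finite sums and nonnegativity of the Hessian form.

module QuadraticForm (em : ExcludedMiddle 0ℓ) (ℝ : CompleteOrderedField) where
  open CompleteOrderedField ℝ
  open OrderedField ℝ
  open Sum +-commutativeMonoid using (∑-distrib-+; sum-cong-≋) public

  private variable
    n : ℕ

  sum-linear : ∀ b c (v w : Fin n → Carrier) → sum (λ i → b * v i + c * w i) ≈ b * sum v + c * sum w
  sum-linear {zero}  b c v w = solve 2 (λ b c → :0 := b :* :0 :+ c :* :0) refl b c
  sum-linear {suc n} b c v w = trans (+-congˡ (sum-linear b c (v ∘ suc) (w ∘ suc)))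
    (solve 6 (λ b c v w vs ws → (b :* v :+ c :* w) :+ (b :* vs :+ c :* ws) := b :* (v :+ vs) :+ c :* (w :+ ws))
      refl b c (v zero) (w zero) (sum (v ∘ suc)) (sum (w ∘ suc)))

  sum-nonneg : {t : Fin n → Carrier} → (∀ i → 0# ≤ t i) → 0# ≤ sum t
  sum-nonneg {zero}  0≤t = ≤-refl
  sum-nonneg {suc n} 0≤t = 0≤t zero ⊕ sum-nonneg (0≤t ∘ suc)

  term≤sum : {t : Fin n → Carrier} → ∀ k → (∀ i → i ≢ k → 0# ≤ t i) → t k ≤ sum t
  term≤sum {suc n} {t} zero    0≤t = ≤-by (sum-nonneg (λ i → 0≤t (suc i) λ ()))
    (solve 2 (λ x s → x :+ s :- x := s) refl (t zero) (sum (t ∘ suc)))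
  term≤sum {suc n} {t} (suc k) 0≤t = ≤-by (0≤t zero (λ ()) ⊕ x≤y⇒0≤y-x
      (term≤sum k (λ i i≢k → 0≤t (suc i) (i≢k ∘ Fin.suc-injective))))
    (solve 3 (λ x y s → x :+ s :- y := x :+ (s :- y)) refl (t zero) (t (suc k)) (sum (t ∘ suc)))

  pair≤sum : {t : Fin n → Carrier} → ∀ i k → i ≢ k → (∀ j → 0# ≤ t j) → t i + t k ≤ sum t
  pair≤sum zero    zero    i≢k 0≤t = ⊥-elim (i≢k ≡.refl)
  pair≤sum {t = t} zero    (suc k) i≢k 0≤t = ≤-by (x≤y⇒0≤y-x (term≤sum k (λ i _ → 0≤t (suc i))))
    (solve 3 (λ x y s → x :+ s :- (x :+ y) := s :- y) refl (t zero) (t (suc k)) (sum (t ∘ suc)))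
  pair≤sum {t = t} (suc i) zero    i≢k 0≤t = ≤-by (x≤y⇒0≤y-x (term≤sum i (λ i _ → 0≤t (suc i))))
    (solve 3 (λ x y s → x :+ s :- (y :+ x) := s :- y) refl (t zero) (t (suc i)) (sum (t ∘ suc)))
  pair≤sum {t = t} (suc i) (suc k) i≢k 0≤t = ≤-by (0≤t zero ⊕ x≤y⇒0≤y-x
      (pair≤sum i k (i≢k ∘ ≡.cong suc) (0≤t ∘ suc)))
    (solve 4 (λ x y z s → x :+ s :- (y :+ z) := x :+ (s :- (y :+ z)))
        refl (t zero) (t (suc i)) (t (suc k)) (sum (t ∘ suc)))

  module _ {n} (p d γ : Fin n → Carrier) (0≤p : ∀ i → 0# ≤ p i) (∑p≈1 : sum p ≈ 1#) (∑d≈0 : sum d ≈ 0#)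
    (support : ∀ i → ¬ (d i ≈ 0#) → 0# < p i) where

    form : Carrier
    form = sum (λ i → γ i * (d i * d i))

    -- Adding the terms - 2κλ dᵢ + κλ² pᵢ, whose sum is κλ², makes the inequality hold
    -- termwise; λ = - dₖ / (1 - pₖ) is the optimal multiplier.
    form-nonneg-large : ∀ k → p k < 1# → ∀ {C} → 0# < C → - C ≤ γ k →
      (∀ i → 0# < p i → p i ≤ 1# - p k → C * (1# - p k) ≤ γ i * p i) → 0# ≤ form
    form-nonneg-large k pₖ<1 {C} 0<C -C≤γₖ C≤γ = ≤-respʳ-≈
        (sym (≈-mod (- κλ²) (≈-mod (κλ + κλ) (≈-mod (- 1#) (solve 6 (λ F S D P κλ κλ² →
            F := (S :- κλ²) :+ (:- κλ²) :* (P :- :1) :+ (κλ :+ κλ) :* (D :- :0) :+ (:- :1) :*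
                (S :- (F :+ ((:- (κλ :+ κλ)) :* D :+ κλ² :* P))))
          refl form (sum T) (sum d) (sum p) κλ κλ²) ∑T) ∑d≈0) ∑p≈1))
        (x≤y⇒0≤y-x (≤-trans T-at-k (term≤sum k T-elsewhere)))
      where
      P κ l κλ κλ² : Carrier
      P   = 1# - p k
      κ   = C * P
      l   = - d k * P ⁻¹
      κλ  = κ * l
      κλ² = κ * (l * l)
      T : Fin n → Carrier
      T i = γ i * (d i * d i) + ((- (κλ + κλ)) * d i + κλ² * p i)

      0<P : 0# < P
      0<P = x<y⇒0<y-x pₖ<1
      0≤κ : 0# ≤ κ
      0≤κ = proj₁ 0<C ⊗ proj₁ 0<P

      ∑T : sum T ≈ form + ((- (κλ + κλ)) * sum d + κλ² * sum p)
      ∑T = trans (∑-distrib-+ (λ i → γ i * (d i * d i)) (λ i → (- (κλ + κλ)) * d i + κλ² * p i))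
          (+-congˡ (sum-linear (- (κλ + κλ)) κλ² d p))

      -- For this `l` the two added terms exceed `κλ²` by exactly `C * (d k * d k)`, which offsets
      -- the worst case `γ k ≈ - C`. The entry `k` alone thus accounts for the whole sum `κλ²` of
      -- the added terms, and the others need only be nonnegative.
      T-at-k : κλ² ≤ T k
      T-at-k = ≤-by (≤-respʳ-≈ (solve 2 (λ g C → g :- (:- C) := g :+ C)
          refl (γ k) C) (x≤y⇒0≤y-x -C≤γₖ) ⊗ sq-nonneg (d k))
        (≈-mod (- C * (d k * d k) * (P * P ⁻¹ - 1#)) (solve 5 (λ g C d p r →
            let P = :1 :- p ; κ = C :* P ; l = (:- d) :* r in
            g :* (d :* d) :+ ((:- (κ :* l :+ κ :* l)) :* d :+ κ :* (l :* l) :* p) :- κ :* (l :* l) :=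
            (g :+ C) :* (d :* d) :+ (:- C) :* (d :* d) :* (P :* r :- :1) :* (P :* r :- :1))
          refl (γ k) C (d k) (p k) (P ⁻¹)) (⁻¹-inverse 0<P))

      -- Multiplied by `p i`, the term becomes `(γ i * p i - κ) * (d i * d i)` plus `κ` times the
      -- square of `d i - l * p i`. This requires `p i` positive; where it may vanish, `d i` is zero
      -- and only `κλ² * p i` remains.
      T-elsewhere : ∀ i → i ≢ k → 0# ≤ T i
      T-elsewhere i i≢k = case d i ≟ 0# of λ
        { (yes dᵢ≈0) → ≤-respʳ-≈ (sym (≈-mod (γ i * d i - (κλ + κλ))
              (solve 5 (λ g d p κλ κλ² → g :* (d :* d) :+ ((:- (κλ :+ κλ)) :* d :+ κλ² :* p) := κλ² :* p :+
                  (g :* d :- (κλ :+ κλ)) :* (d :- :0)) refl (γ i) (d i) (p i) κλ κλ²) dᵢ≈0))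
            (0≤κ ⊗ sq-nonneg l ⊗ 0≤p i)
        ; (no dᵢ≉0) → *-cancelˡ-nonneg (support i dᵢ≉0) (≤-respʳ-≈
            (solve 5 (λ g d p κ l → (g :* p :- κ) :* (d :* d) :+ κ :* ((d :- l :* p) :* (d :- l :* p)) :=
              p :* (g :* (d :* d) :+ ((:- (κ :* l :+ κ :* l)) :* d :+ κ :* (l :* l) :* p)))
                  refl (γ i) (d i) (p i) κ l)
            (x≤y⇒0≤y-x (C≤γ i (support i dᵢ≉0) pᵢ≤P) ⊗ sq-nonneg (d i) ⊕ 0≤κ ⊗ sq-nonneg (d i - l * p i))) }
        where
        pᵢ≤P : p i ≤ P
        pᵢ≤P = ≤-by (x≤y⇒0≤y-x (≤-respʳ-≈ ∑p≈1 (pair≤sum i k i≢k 0≤p)))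
            (solve 2 (λ p q → :1 :- q :- p := :1 :- (p :+ q)) refl (p i) (p k))

    -- The split is over entries that exceed `½` and also move: a large entry at rest contributes
    -- zero, so in the absence of a moving one every term is nonnegative by itself.
    form-nonneg : (∀ i → p i ≤ ½ → ¬ (d i ≈ 0#) → 0# ≤ γ i) →
      (∀ k → ½ < p k → ¬ (d k ≈ 0#) → p k < 1# × ∃[ C ] 0# < C × - C ≤ γ k ×
        (∀ i → 0# < p i → p i ≤ 1# - p k → C * (1# - p k) ≤ γ i * p i)) →
      0# ≤ form
    form-nonneg small large = case em {P = ∃[ k ] ½ < p k × ¬ (d k ≈ 0#)} of λ
      { (yes (k , ½<pₖ , dₖ≉0)) → case large k ½<pₖ dₖ≉0 of λ
          (pₖ<1 , C , 0<C , -C≤γₖ , C≤γ) → form-nonneg-large k pₖ<1 0<C -C≤γₖ C≤γ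
      ; (no none) → sum-nonneg λ i → case d i ≟ 0# of λ
          { (yes dᵢ≈0) → ≤-reflexive (sym (≈-mod (γ i * d i)
                  (solve 2 (λ g d → g :* (d :* d) := :0 :+ g :* d :* (d :- :0)) refl (γ i) (d i)) dᵢ≈0))
          ; (no dᵢ≉0) → case p i ≤? ½ of λ
              { (yes pᵢ≤½) → small i pᵢ≤½ dᵢ≉0 ⊗ sq-nonneg (d i)
              ; (no pᵢ≰½) → ⊥-elim (none (i , ≰⇒> pᵢ≰½ , dᵢ≉0)) } } }

-- From the hypotheses on `g″` to convexity on the simplex.

module SimplexConvexity (em : ExcludedMiddle 0ℓ) (ℝ : CompleteOrderedField) where
  open CompleteOrderedField ℝ
  open Analysis ℝ
  open OrderedField ℝ
  open RealAnalysis em ℝ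
  open QuadraticForm em ℝ

  withValueAt-≈ : ∀ h → x ≈ a → withValueAt a v h x ≡ v
  withValueAt-≈ {x} {a} h x≈a with x ≟ a
  ... | yes _   = ≡.refl
  ... | no  x≉a = ⊥-elim (x≉a x≈a)

  withValueAt-≉ : ∀ h → ¬ (x ≈ a) → withValueAt a v h x ≡ h x
  withValueAt-≉ {x} {a} h x≉a with x ≟ a
  ... | yes x≈a = ⊥-elim (x≉a x≈a)
  ... | no  _   = ≡.refl

  -- Of two distinct nonnegative numbers the larger is positive, and so is its weight.
  combination-pos : 0# ≤ x → 0# ≤ y → ¬ (x ≈ y) → c ∈ ⦅ 0# , 1# ⦆ → 0# < c * x + (1# - c) * y
  combination-pos {x} {y} {c} 0≤x 0≤y x≉y (0<c , c<1) = case total x y of λ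
    { (inj₁ x≤y) → <-respʳ-≈ (solve 3 (λ c x y → (:1 :- c) :* y :+ c :* x := c :* x :+ (:1 :- c) :* y)
            refl c x y)
        (x<y⇒0<y-x c<1 +⊗ ≤-<-trans 0≤x (x≤y , x≉y) +⊕ proj₁ 0<c ⊗ 0≤x)
    ; (inj₂ y≤x) → 0<c +⊗ ≤-<-trans 0≤y (y≤x , x≉y ∘ sym) +⊕ x≤y⇒0≤y-x (proj₁ c<1) ⊗ 0≤y }

  combination-nonneg : 0# ≤ x → 0# ≤ y → c ∈ ⟦ 0# , 1# ⟧ → 0# ≤ c * x + (1# - c) * y
  combination-nonneg 0≤x 0≤y (0≤c , c≤1) = 0≤c ⊗ 0≤x ⊕ x≤y⇒0≤y-x c≤1 ⊗ 0≤y

  combination-complement : ∀ c x y → 1# - (c * x + (1# - c) * y) ≈ c * (1# - x) + (1# - c) * (1# - y)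
  combination-complement = solve 3 (λ c x y → :1 :- (c :* x :+ (:1 :- c) :* y) := c :* (:1 :- x) :+ (:1 :- c) :*
      (:1 :- y)) refl

  combination-unit : x ∈ ⟦ 0# , 1# ⟧ → y ∈ ⟦ 0# , 1# ⟧ → c ∈ ⟦ 0# , 1# ⟧ → c * x + (1# - c) * y ∈ ⟦ 0# , 1# ⟧
  combination-unit {x} {y} {c} (0≤x , x≤1) (0≤y , y≤1) c∈ = combination-nonneg 0≤x 0≤y c∈ ,
    ≤-by (combination-nonneg (x≤y⇒0≤y-x x≤1) (x≤y⇒0≤y-x y≤1) c∈) (combination-complement c x y)

  combination-interior : x ∈ ⟦ 0# , 1# ⟧ → y ∈ ⟦ 0# , 1# ⟧ → ¬ (x ≈ y) → c ∈ ⦅ 0# , 1# ⦆ →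
    c * x + (1# - c) * y ∈ ⦅ 0# , 1# ⦆
  combination-interior {x} {y} {c} (0≤x , x≤1) (0≤y , y≤1) x≉y c∈ = combination-pos 0≤x 0≤y x≉y c∈ ,
    <-by (combination-pos (x≤y⇒0≤y-x x≤1) (x≤y⇒0≤y-x y≤1)
      (λ eq → x≉y (≈-mod (- 1#) (solve 2 (λ x y → x := y :+ (:- :1) :* ((:1 :- x) :- (:1 :- y)))
          refl x y) eq)) c∈)
      (combination-complement c x y)

  shift-closed : x ∈ ⟦ 0# , 1# ⟧ → x - ½ ∈ ⟦ - ½ , ½ ⟧
  shift-closed {x} (0≤x , x≤1) = ≤-by 0≤x (solve 2 (λ x h → x :- h :- (:- h) := x) refl x ½) ,
    ≤-by (x≤y⇒0≤y-x x≤1) (≈-mod 1# (solve 2 (λ x h → h :- (x :- h) := :1 :- x :+ :1 :* (h :+ h :- :1))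
        refl x ½) ½-twice)

  shift-open : x ∈ ⦅ 0# , 1# ⦆ → x - ½ ∈ ⦅ - ½ , ½ ⦆
  shift-open {x} (0<x , x<1) = <-by 0<x (solve 2 (λ x h → x :- h :- (:- h) := x) refl x ½) ,
    <-by (x<y⇒0<y-x x<1) (≈-mod 1# (solve 2 (λ x h → h :- (x :- h) := :1 :- x :+ :1 :* (h :+ h :- :1))
        refl x ½) ½-twice)

  shift-lower : 0# < x → x < ½ → x - ½ ∈ ⦅ - ½ , 0# ⦆
  shift-lower {x} 0<x x<½ = <-by 0<x (solve 2 (λ x h → x :- h :- (:- h) := x) refl x ½) ,
    <-by (x<y⇒0<y-x x<½) (solve 2 (λ x h → :0 :- (x :- h) := h :- x) refl x ½)

  unshift-closed : x ∈ ⟦ - ½ , ½ ⟧ → ½ + x ∈ ⟦ 0# , 1# ⟧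
  unshift-closed {x} (-½≤x , x≤½) = ≤-by (x≤y⇒0≤y-x -½≤x) (solve 2 (λ x h → h :+ x :- :0 := x :- (:- h))
      refl x ½) ,
    ≤-by (x≤y⇒0≤y-x x≤½) (≈-mod 1# (solve 2 (λ x h → :1 :- (h :+ x) := h :- x :+ :1 :* (:1 :- (h :+ h)))
        refl x ½) (sym ½-twice))

  lower⊆open : x ∈ ⦅ - ½ , 0# ⦆ → x ∈ ⦅ - ½ , ½ ⦆
  lower⊆open (-½<x , x<0) = -½<x , <-trans x<0 0<½

  open⊆closed : x ∈ ⦅ - ½ , ½ ⦆ → x ∈ ⟦ - ½ , ½ ⟧
  open⊆closed (-½<x , x<½) = proj₁ -½<x , proj₁ x<½

  module _ (g″ : Carrier → Carrier) (g″-cong : CongruentOn ⦅ - ½ , ½ ⦆ g″)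
    (g″-pos : ∀ {t} → t ∈ ⦅ - ½ , 0# ⦆ → 0# < g″ t)
    (convex : ConvexOn ⟦ - ½ , 0# ⦆ (withValueAt (- ½) 0# (λ t → 1# / g″ t))) where

    -- Convexity of 1/g″ along the segment from - ½, where it vanishes, makes
    -- (1/g″)(x - ½) / x increasing in x.
    scaled-antitone : ∀ {p P} → 0# < p → p ≤ P → P < ½ → g″ (P - ½) * P ≤ g″ (p - ½) * p
    scaled-antitone {p} {P} 0<p p≤P P<½ = ≤-respʳ-≈
        (*-congʳ (g″-cong (lower⊆open m∈) (lower⊆open (shift-lower 0<p p<½)) m≈p-½))
      -- Convexity reads `1 / g″ m ≤ (p / P) / g″ t₁`; multiplying by `g″ m * g″ t₁ * P` clears the
      -- denominators.
      (≤-by (proj₁ (0<g″m +⊗ 0<g″t₁ +⊗ 0<P) ⊗ x≤y⇒0≤y-x reciprocal≤)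
        (≈-mod (g″ t₁ * P) (≈-mod (- (g″ m * p)) (≈-mod (- (g″ m * p * (P * P ⁻¹)))
            (solve 7 (λ a b a′ b′ p P R →
            a :* p :- b :* P := a :* b :* P :* (p :* R :* (:1 :* b′) :+ (:1 :- p :* R) :* :0 :- :1 :* a′)
              :+ b :* P :* (a :* a′ :- :1) :+ (:- (a :* p)) :* (P :* R :- :1) :+ (:- (a :* p :* (P :* R))) :*
                  (b :* b′ :- :1))
          refl (g″ m) (g″ t₁) (g″ m ⁻¹) (g″ t₁ ⁻¹) p P (P ⁻¹)) (⁻¹-inverse 0<g″t₁)) (⁻¹-inverse 0<P))
              (⁻¹-inverse 0<g″m)))
      where
      s t₁ m : Carrier
      -- With this weight the combination `m` of `t₁` and `- ½` is `p - ½`, but only up to `≈`, so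
      -- passing from `g″ m` to `g″ (p - ½)` takes congruence of `g″`.
      s  = p * P ⁻¹
      t₁ = P - ½
      m  = s * t₁ + (1# - s) * - ½
      0<P : 0# < P
      0<P = <-≤-trans 0<p p≤P
      p<½ : p < ½
      p<½ = ≤-<-trans p≤P P<½
      m≈p-½ : m ≈ p - ½
      m≈p-½ = ≈-mod p (solve 4 (λ p P R h → p :* R :* (P :- h) :+ (:1 :- p :* R) :* (:- h) := p :- h :+ p :*
          (P :* R :- :1)) refl p P (P ⁻¹) ½) (⁻¹-inverse 0<P)
      t₁∈ : t₁ ∈ ⦅ - ½ , 0# ⦆
      t₁∈ = shift-lower 0<P P<½
      m∈ : m ∈ ⦅ - ½ , 0# ⦆
      m∈ = <-respʳ-≈ (sym m≈p-½) (proj₁ (shift-lower 0<p p<½)) , <-respˡ-≈ (sym m≈p-½)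
          (proj₂ (shift-lower 0<p p<½))
      0<g″m : 0# < g″ m
      0<g″m = g″-pos m∈
      0<g″t₁ : 0# < g″ t₁
      0<g″t₁ = g″-pos t₁∈
      s∈ : s ∈ ⟦ 0# , 1# ⟧
      s∈ = proj₁ 0<p ⊗ proj₁ (⁻¹-pos 0<P) ,
        ≤-by (x≤y⇒0≤y-x p≤P ⊗ proj₁ (⁻¹-pos 0<P))
          (≈-mod 1# (solve 3 (λ p P R → :1 :- p :* R := (P :- p) :* R :+ :1 :* (:1 :- P :* R))
              refl p P (P ⁻¹)) (sym (⁻¹-inverse 0<P)))

      φ : Carrier → Carrier
      φ t = 1# / g″ t
      reciprocal≤ : φ m ≤ s * φ t₁ + (1# - s) * 0#
      reciprocal≤ = ≡.subst₂ (λ u v → u ≤ s * v + (1# - s) * 0#)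
        (withValueAt-≉ φ (proj₂ (proj₁ m∈) ∘ sym)) (withValueAt-≉ φ (proj₂ (proj₁ t₁∈) ∘ sym))
        (≡.subst (λ v → withValueAt (- ½) 0# φ m ≤ s * withValueAt (- ½) 0# φ t₁ + (1# - s) * v)
            (withValueAt-≈ φ refl)
          (convex (proj₁ (proj₁ t₁∈) , proj₂ t₁∈) (≤-refl , <-by 0<½ (solve 1 (λ h → :0 :- (:- h) := h)
              refl ½)) s∈))

  unit-entries : ∀ {n} {p : Fin n → Carrier} → p ∈ Simplex n → ∀ i → p i ∈ ⟦ 0# , 1# ⟧
  unit-entries (0≤p , ∑p≈1) i = 0≤p i , ≤-respʳ-≈ ∑p≈1 (term≤sum i (λ j _ → 0≤p j))

  module _ (f : Carrier → Carrier) (f-cont : ContinuousOn ⟦ 0# , 1# ⟧ f) (g″ : Carrier → Carrier)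
    (g-second : SecondDerivativeOn ⦅ - ½ , ½ ⦆ (λ t → f (½ + t)) g″)
    (g″-pos : ∀ {t} → t ∈ ⦅ - ½ , 0# ⦆ → 0# < g″ t) (0≤g″0 : 0# ≤ g″ 0#)
    (g″-reflect : ∀ {t} → t ∈ ⦅ 0# , ½ ⦆ → - g″ (- t) ≤ g″ t)
    (convex : ConvexOn ⟦ - ½ , 0# ⦆ (withValueAt (- ½) 0# (λ t → 1# / g″ t))) where

    g g′ : Carrier → Carrier
    g t = f (½ + t)
    g′ = proj₁ g-second

    f-cong : CongruentOn ⟦ 0# , 1# ⟧ f
    f-cong = continuousOn⇒congruentOn f-cont

    g-cont : ContinuousOn ⟦ - ½ , ½ ⟧ g
    g-cont = continuousOn-∘ {h = f} unshift-closed
      (continuousOn-affine {d = 1#} λ x y → solve 3 (λ h x y → h :+ y :- (h :+ x) := :1 :* (y :- x))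
          refl ½ x y) f-cont

    g-cong : CongruentOn ⟦ - ½ , ½ ⟧ g
    g-cong = continuousOn⇒congruentOn g-cont

    g′-cong : CongruentOn ⦅ - ½ , ½ ⦆ g′
    g′-cong = derivative-congruent {h′ = g′} (λ x∈ y∈ → g-cong (open⊆closed x∈) (open⊆closed y∈))
        (proj₁ (proj₂ g-second))

    g″-cong : CongruentOn ⦅ - ½ , ½ ⦆ g″
    g″-cong = derivative-congruent {h′ = g″} g′-cong (proj₂ (proj₂ g-second))

    g-symmetricLowerAt : ∀ {t} → t ∈ ⦅ - ½ , ½ ⦆ → SymmetricLowerAt ⟦ - ½ , ½ ⟧ g t (g″ t)
    g-symmetricLowerAt t∈ = second-derivative⇒symmetricLowerAt {h′ = g′} g-cong (proj₁ (proj₂ g-second)) t∈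
      (derivativeOn⇒hasDerivativeAt {h′ = g″} (proj₂ (proj₂ g-second)) g′-cong t∈)

    module _ {n} (p d : Fin n → Carrier) (p∈ : p ∈ Simplex n) (∑d≈0 : sum d ≈ 0#)
      (interior : ∀ i → ¬ (d i ≈ 0#) → p i ∈ ⦅ 0# , 1# ⦆) where

      γ : Fin n → Carrier
      γ i = g″ (p i - ½)

      small : ∀ i → p i ≤ ½ → ¬ (d i ≈ 0#) → 0# ≤ γ i
      small i pᵢ≤½ dᵢ≉0 = case p i ≟ ½ of λ
        { (yes pᵢ≈½) → ≤-respʳ-≈ (g″-cong 0∈ (shift-open (interior i dᵢ≉0))
              (≈-mod (- 1#) (solve 2 (λ p h → :0 := p :- h :+ (:- :1) :* (p :- h)) refl (p i) ½) pᵢ≈½)) 0≤g″0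
        ; (no pᵢ≉½) → proj₁ (g″-pos (shift-lower (proj₁ (interior i dᵢ≉0)) (pᵢ≤½ , pᵢ≉½))) }
        where
        0∈ : 0# ∈ ⦅ - ½ , ½ ⦆
        0∈ = <-by 0<½ (solve 1 (λ h → :0 :- (:- h) := h) refl ½) , 0<½

      -- The mirror image of `p k` in `½` is `1# - p k`, the total of the other entries. Reflection
      -- and `scaled-antitone` therefore involve the same value of `g″`, which is taken as `C`.
      large : ∀ k → ½ < p k → ¬ (d k ≈ 0#) → p k < 1# × ∃[ C ] 0# < C × - C ≤ γ k ×
        (∀ i → 0# < p i → p i ≤ 1# - p k → C * (1# - p k) ≤ γ i * p i)
      large k ½<pₖ dₖ≉0 = proj₂ pₖ∈ , g″ (1# - p k - ½) , g″-pos 1-pₖ∈ ,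
        ≤-respˡ-≈ (-‿cong (g″-cong (<-respʳ-≈ (sym reflected) (proj₁ 1-pₖ∈′) , <-respˡ-≈ (sym reflected)
            (proj₂ 1-pₖ∈′)) 1-pₖ∈′ reflected))
          (g″-reflect (<-by (x<y⇒0<y-x ½<pₖ) (solve 2 (λ p h → p :- h :- :0 := p :- h)
              refl (p k) ½) , proj₂ (shift-open pₖ∈))) ,
        λ i 0<pᵢ pᵢ≤P → scaled-antitone g″ g″-cong g″-pos convex 0<pᵢ pᵢ≤P P<½
        where
        pₖ∈ : p k ∈ ⦅ 0# , 1# ⦆
        pₖ∈ = interior k dₖ≉0
        P<½ : 1# - p k < ½
        P<½ = <-by (x<y⇒0<y-x ½<pₖ) (≈-mod 1# (solve 2
            (λ p h → h :- (:1 :- p) := p :- h :+ :1 :* (h :+ h :- :1)) refl (p k) ½) ½-twice)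
        1-pₖ∈ : 1# - p k - ½ ∈ ⦅ - ½ , 0# ⦆
        1-pₖ∈ = shift-lower (x<y⇒0<y-x (proj₂ pₖ∈)) P<½
        1-pₖ∈′ : 1# - p k - ½ ∈ ⦅ - ½ , ½ ⦆
        1-pₖ∈′ = lower⊆open 1-pₖ∈
        reflected : - (p k - ½) ≈ 1# - p k - ½
        reflected = ≈-mod 1# (solve 2 (λ p h → :- (p :- h) := :1 :- p :- h :+ :1 :* (h :+ h :- :1))
            refl (p k) ½) ½-twice

      hessian-nonneg : 0# ≤ sum (λ i → γ i * (d i * d i))
      hessian-nonneg = form-nonneg p d γ (proj₁ p∈) (proj₂ p∈) ∑d≈0
          (λ i dᵢ≉0 → proj₁ (interior i dᵢ≉0)) small large

    module _ {n} {p q : Fin n → Carrier} (p∈ : p ∈ Simplex n) (q∈ : q ∈ Simplex n) where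

      seg : Carrier → Fin n → Carrier
      seg t i = t * p i + (1# - t) * q i

      -- p - q, written as the linear combination that sum-linear expects.
      Δ : Fin n → Carrier
      Δ i = 1# * p i + (- 1#) * q i

      -- Written through `g`, so that its second-order bounds apply by composition; since
      -- `½ + (x - ½)` is `x` only up to `≈`, the return to `f` is made at the end by `g≈f`.
      G : Carrier → Carrier
      G t = sum (λ i → g (seg t i - ½))

      seg-unit : ∀ {t} → t ∈ ⟦ 0# , 1# ⟧ → ∀ i → seg t i ∈ ⟦ 0# , 1# ⟧
      seg-unit t∈ i = combination-unit (unit-entries p∈ i) (unit-entries q∈ i) t∈

      seg-affine : ∀ i s t → seg t i - ½ - (seg s i - ½) ≈ Δ i * (t - s)
      seg-affine i s t = solve 5 (λ p q s t h → (t :* p :+ (:1 :- t) :* q :- h) :-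
          (s :* p :+ (:1 :- s) :* q :- h) := (:1 :* p :+ (:- :1) :* q) :* (t :- s)) refl (p i) (q i) s t ½

      ∑Δ≈0 : sum Δ ≈ 0#
      ∑Δ≈0 = trans (sum-linear 1# (- 1#) p q) (≈-mod 1#
          (≈-mod (- 1#) (solve 2 (λ P Q → :1 :* P :+ (:- :1) :* Q := :0 :+ :1 :* (P :- :1) :+ (:- :1) :*
          (Q :- :1)) refl (sum p) (sum q)) (proj₂ q∈)) (proj₂ p∈))

      seg-simplex : ∀ {t} → t ∈ ⟦ 0# , 1# ⟧ → seg t ∈ Simplex n
      seg-simplex {t} t∈ = (λ i → proj₁ (seg-unit t∈ i)) , trans (sum-linear t (1# - t) p q)
        (≈-mod t (≈-mod (1# - t) (solve 3 (λ t P Q → t :* P :+ (:1 :- t) :* Q := :1 :+ t :* (P :- :1) :+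
            (:1 :- t) :* (Q :- :1)) refl t (sum p) (sum q)) (proj₂ q∈)) (proj₂ p∈))

      G-cont : ContinuousOn ⟦ 0# , 1# ⟧ G
      G-cont = continuousOn-sum {h = λ i t → g (seg t i - ½)} λ i →
        continuousOn-∘ {h = g} (λ t∈ → shift-closed (seg-unit t∈ i)) (continuousOn-affine (seg-affine i)) g-cont

      G-lower : ∀ {t} → t ∈ ⦅ 0# , 1# ⦆ → SymmetricLowerAt ⟦ 0# , 1# ⟧ G t 0#
      G-lower {t} t∈@(0<t , t<1) = symmetricLowerAt-mono
          (hessian-nonneg (seg t) Δ (seg-simplex t∈′) ∑Δ≈0 interior)
        (symmetricLowerAt-sum {h = λ i s → g (seg s i - ½)} term)
        where
        t∈′ : t ∈ ⟦ 0# , 1# ⟧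
        t∈′ = proj₁ 0<t , proj₁ t<1
        interior : ∀ i → ¬ (Δ i ≈ 0#) → seg t i ∈ ⦅ 0# , 1# ⦆
        interior i Δᵢ≉0 = combination-interior (unit-entries p∈ i) (unit-entries q∈ i)
          (λ pᵢ≈qᵢ → Δᵢ≉0 (≈-mod 1# (solve 2 (λ p q → :1 :* p :+ (:- :1) :* q := :0 :+ :1 :* (p :- q))
              refl (p i) (q i)) pᵢ≈qᵢ)) t∈
        term : ∀ i → SymmetricLowerAt ⟦ 0# , 1# ⟧ (λ s → g (seg s i - ½)) t (g″ (seg t i - ½) * (Δ i * Δ i))
        term i = case Δ i ≟ 0# of λ
          -- A coordinate at rest may lie at 0 or 1, where the value of `g″` is arbitrary; the
          -- factor `Δ i * Δ i` cancels it.
          { (yes Δᵢ≈0) → symmetricLowerAt-const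
              (λ {s} s∈ → g-cong (shift-closed (seg-unit s∈ i)) (shift-closed (seg-unit t∈′ i))
                (≈-mod (s - t) (≈-mod 1# (solve 4 (λ a b d e → a := b :+ e :* (d :- :0) :+ :1 :*
                    (a :- b :- d :* e)) refl (seg s i - ½) (seg t i - ½) (Δ i) (s - t))
                    (seg-affine i t s)) Δᵢ≈0))
              (≤-reflexive (≈-mod (g″ (seg t i - ½) * Δ i)
                  (solve 2 (λ g d → g :* (d :* d) := :0 :+ g :* d :* (d :- :0))
                  refl (g″ (seg t i - ½)) (Δ i)) Δᵢ≈0))
          ; (no Δᵢ≉0) → symmetricLowerAt-∘ {h = g} (λ s∈ → shift-closed (seg-unit s∈ i)) (seg-affine i t)
              (g-symmetricLowerAt (shift-open (interior i Δᵢ≉0))) }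

      g≈f : x ∈ ⟦ 0# , 1# ⟧ → y ∈ ⟦ 0# , 1# ⟧ → x ≈ y → g (x - ½) ≈ f y
      g≈f {x} {y} x∈ y∈ x≈y = f-cong (unshift-closed (shift-closed x∈)) y∈
          (trans (solve 2 (λ h x → h :+ (x :- h) := x) refl ½ x) x≈y)

      below-chord : ∀ {s} → s ∈ ⟦ 0# , 1# ⟧ →
        sum (λ i → f (seg s i)) ≤ s * sum (λ i → f (p i)) + (1# - s) * sum (λ i → f (q i))
      below-chord {s} s∈ = ≤-respˡ-≈ (sum-cong-≋ (λ i → g≈f (seg-unit s∈ i) (seg-unit s∈ i) refl))
        (≤-respʳ-≈ (+-cong
            (*-congˡ (sum-cong-≋ (λ i → g≈f (seg-unit (proj₁ 0<1 , ≤-refl) i) (unit-entries p∈ i)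
                (solve 2 (λ p q → :1 :* p :+ (:1 :- :1) :* q := p) refl (p i) (q i)))))
            (*-congˡ (sum-cong-≋ (λ i → g≈f (seg-unit (≤-refl , proj₁ 0<1) i) (unit-entries q∈ i)
                (solve 2 (λ p q → :0 :* p :+ (:1 :- :0) :* q := q) refl (p i) (q i))))))
          (symmetricLower⇒below-chord G G-cont G-lower s∈))

    simplexConvex : SimplexConvex f
    simplexConvex n _ p∈ q∈ = below-chord p∈ q∈

theorem5p5 :
    ExcludedMiddle 0ℓ →
    (ℝ : CompleteOrderedField) →
    let open CompleteOrderedField ℝ
        open Analysis ℝ
    in
    (f : Carrier → Carrier) →
    ContinuousOn ⟦ 0# , 1# ⟧ f →
    TwiceDifferentiableOn ⦅ 0# , 1# ⦆ f →
    let g = λ t → f (½ + t) in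
    (g″ : Carrier → Carrier) →
    SecondDerivativeOn ⦅ - ½ , ½ ⦆ g g″ →
    (∀ {t} → t ∈ ⦅ - ½ , 0# ⦆ → 0# < g″ t) →
    0# ≤ g″ 0# →
    (∀ {t} → t ∈ ⦅ 0# , ½ ⦆ → - g″ (- t) ≤ g″ t) →
    Limit ⦅ - ½ , ½ ⦆ (λ t → 1# / g″ t) (- ½) 0# →
    ConvexOn ⟦ - ½ , 0# ⦆ (withValueAt (- ½) 0# (λ t → 1# / g″ t)) →
    SimplexConvex f
theorem5p5 em ℝ f f-cont _ g″ g-second g″-pos 0≤g″0 g″-reflect _ convex =
  SimplexConvexity.simplexConvex em ℝ f f-cont g″ g-second g″-pos 0≤g″0 g″-reflect convex
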